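{- Let $\mathfrak S=(S,F,\leq)$ be an $\infty$-effective complete WSTS and let $s_0\in S$. The following statements are equivalent: (1) $(\mathfrak S,s_0)$ is clover-flattable; (2) $(\mathfrak S,s_0)$ is weakly clover-flattable; (3) $(\mathfrak S,s_0)$ is strongly clover-flattable; (4) the procedure $\mathbf{Clover}_{\mathfrak S}$ terminates on input $s_0$.
   Context: Order theory. For a poset $(X,\leq)$ and $E\subseteq X$: ${\downarrow}E=\{y\mid \exists x\in E,\ y\leq x\}$, ${\uparrow}E$ dually; $\mathrm{Max}\,E$ is the set of maximal elements of $E$. A directed subset is a nonempty set in which any two elements have an upper bound in the set. A dcpo is a poset in which every directed subset $D$ has a least upper bound $\bigvee D$. On a dcpo, $x\ll y$ iff for every directed $D$ with $\bigvee D\geq y$ there is $z\in D$ with $x\leq z$; the dcpo is continuous iff for every $x$, $\{y\mid y\ll x\}$ is directed with supremum $x$. A well partial order (wpo) is a poset in which every infinite sequence $x_0,x_1,\dots$ has $i<j$ with $x_i\leq x_j$. A dcwo is a poset that is both a dcpo and a wpo. A set $U$ is Scott-open iff it is upward-closed and every directed $D$ with $\bigvee D\in U$ meets $U$; closed sets are complements of open sets, $cl(A)$ is the smallest closed set containing $A$; a map is continuous iff preimages of open sets are open. $\mathrm{Lub}(E)=\{\bigvee D\mid D\subseteq E\text{ directed}\}$. Transition systems. A functional transition system $(S,F)$ consists of a set $S$ and a finite set $F$ of partial maps $S\to S$; $s\to s'$ iff $s'=f(s)$ for some $f\in F$ with $s\in\mathrm{dom} f$. $F^*$ denotes the set of finite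 compositions of maps of $F$ (words over $F$, where the word $fg$ denotes $g\circ f$). For $A\subseteq S$, $Post_{\mathfrak S}(A)=\{f(a)\mid f\in F, a\in A\cap \mathrm{dom} f\}$, $Post^*_{\mathfrak S}$ its reflexive-transitive iterate, and with an ordering, $Cover_{\mathfrak S}(s_0)={\downarrow}Post^*_{\mathfrak S}({\downarrow}s_0)$. A partial map $f$ on a dcpo is partial continuous iff $\mathrm{dom} f$ is Scott-open and $f(\bigvee D)=\bigvee f(D)$ for every directed $D\subseteq \mathrm{dom} f$. A complete transition system is a functional transition system $(S,F,\leq)$ with $(S,\leq)$ a continuous dcwo and every $f\in F$ partial continuous; a complete WSTS is the same thing (it is a functional WSTS). The clover is $Clover_{\mathfrak S}(s_0)=\mathrm{Max}\,\mathrm{Lub}(Cover_{\mathfrak S}(s_0))$. The lub-acceleration of a partial continuous $g$ is $g^\infty$ with $\mathrm{dom}\, g^\infty=\mathrm{dom}\, g$, $g^\infty(x)=\bigvee_{n}g^n(x)$ if $x<g(x)$, and $g^\infty(x)=g(x)$ otherwise. Effectiveness. States are represented by natural-number codes (via a surjection from a set of codes onto $S$); $\mathfrak S$ is effective iff $\leq$ is decidable on codes and, for each $f\in F$, membership in $\mathrm{dom} f$ is decidable and $f$ is computable. An effective complete WSTS is $\infty$-effective iff $g^\infty$ is computable for every $g\in F^*$. Procedure $\mathbf{Clover}_{\mathfrak S}(s_0)$: write $A\leq^\flat B$ iff ${\downarrow}A\subseteq{\downarrow}B$. Set $A\leftarrow\{s_0\}$; while $Post_{\mathfrak S}(A)\not\leq^\flat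 A$: choose fairly a pair $(g,a)\in F^*\times A$ with $a\in\mathrm{dom}\, g$ and set $A\leftarrow A\cup\{g^\infty(a)\}$; finally return $\mathrm{Max}\,A$. With $A_m$ the value of $A$ after $m$ iterations, fairness means: on every infinite execution, every pair $(g,a)\in F^*\times A_m$ with $a\in \mathrm{dom}\, g$ is picked at some later iteration $n\geq m$. Flattenings. A functional transition system with initial state $s_1$ is flat iff there are finitely many words $w_1,\dots,w_k\in F^*$ such that every sequence of transitions fireable from $s_1$ lies in the language $w_1^*w_2^*\cdots w_k^*$. A flattening of $\mathfrak S_2=(S_2,F_2)$ is a pair $(\mathfrak S_1,\varphi)$ where $\mathfrak S_1=(S_1,F_1)$ is a flat functional transition system (flat with respect to the initial state $s_1$ considered) and $\varphi$ consists of maps $S_1\to S_2$ and $F_1\to F_2$ such that whenever $s\in\mathrm{dom} f_1$ then $\varphi(s)\in\mathrm{dom}\,\varphi(f_1)$ and $\varphi(f_1(s))=\varphi(f_1)(\varphi(s))$. It is continuous iff $\mathfrak S_1$ is a complete transition system and $\varphi:S_1\to S_2$ is Scott-continuous. $(\mathfrak S,s_0)$ is clover-flattable iff there are a continuous flattening $(\mathfrak S_1,\varphi)$ of $\mathfrak S$ and a state $s_1$ of $\mathfrak S_1$ with $\varphi(s_1)=s_0$ and $cl(Cover_{\mathfrak S}(s_0))=cl(\varphi\langle cl(Cover_{\mathfrak S_1}(s_1))\rangle)$ (where $\varphi\langle B\rangle$ is the image of $B$). It is weakly clover-flattable iff the same holds with $\varphi(s_1)\leq s_0$ and $cl(Cover_{\mathfrak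 S}(s_0))\subseteq cl(\varphi\langle cl(Cover_{\mathfrak S_1}(s_1))\rangle)$. An rl-automaton over alphabet $F$ is a deterministic finite automaton $\mathcal A=(F,Q,\delta,q_0)$ (with partial transition function $\delta:Q\times F\to Q$) all of whose states are final and which recognizes a language $\mathrm{Pfx}(w_1^*\cdots w_k^*)$ (set of prefixes) for some words $w_i\in F^*$. The synchronized product $\mathfrak S\times\mathcal A$ has states $S\times Q$, ordered by $(s,q)\leq(s',q')$ iff $s\leq s'$ and $q=q'$, and maps $f\bowtie\delta:(s,q)\mapsto(f(s),\delta(q,f))$ (defined when $s\in\mathrm{dom} f$ and $\delta(q,f)$ defined), one for each $f\in F$ with $\delta(q,f)$ defined for some $q$; $\pi_1(s,q)=s$. $(\mathfrak S,s_0)$ is strongly clover-flattable iff there is an rl-automaton $\mathcal A$ with initial state $q_0$ such that $cl(Cover_{\mathfrak S}(s_0))=cl(\pi_1\langle cl(Cover_{\mathfrak S\times\mathcal A}(s_0,q_0))\rangle)$. -}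

module Defs where

open import Level using (Level; _⊔_; 0ℓ) renaming (suc to lsuc)
open import Data.Nat using (ℕ; zero; suc; _<_) renaming (_≤_ to _≤ℕ_)
open import Data.Fin using (Fin)
open import Data.List using (List; []; _∷_; _++_; [_]; concat; replicate)
open import Data.List.Membership.Propositional using () renaming (_∈_ to _∈ₗ_)
open import Data.Maybe using (Maybe; just; nothing)
open import Data.Product using (Σ; ∃; ∃₂; _×_; _,_; proj₁; proj₂)
open import Data.Sum using (_⊎_)
open import Relation.Binary.PropositionalEquality using (_≡_; _≢_)
open import Relation.Binary.Structures using (IsPartialOrder)
open import Relation.Nullary using (¬_; Dec)
open import Function.Bundles using (_⇔_)

module _ {X : Set} (_≤_ : X → X → Set) where

  UpperBound : (X → Set) → X → Set
  UpperBound D u = ∀ x → D x → x ≤ u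

  IsLub : (X → Set) → X → Set
  IsLub D l = UpperBound D l × (∀ u → UpperBound D u → l ≤ u)

  Directed : (X → Set) → Set
  Directed D = (∃ λ x → D x)
             × (∀ x y → D x → D y → ∃ λ z → D z × x ≤ z × y ≤ z)

  IsDcpo : Set₁
  IsDcpo = ∀ (D : X → Set) → Directed D → ∃ λ l → IsLub D l

  WayBelow : X → X → Set₁
  WayBelow x y = ∀ (D : X → Set) → Directed D → ∀ l → IsLub D l → y ≤ l
               → ∃ λ z → D z × x ≤ z

  -- continuity of a dcpo; {y | y ≪ x} lives in Set₁, so directedness and
  -- lub are spelled out for it directly
  IsContinuous : Set₁
  IsContinuous = ∀ x →
      ((∃ λ y → WayBelow y x)
       × (∀ y z → WayBelow y x → WayBelow z x → ∃ λ u → WayBelow u x × y ≤ u × z ≤ u))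
    × ((∀ y → WayBelow y x → y ≤ x)
       × (∀ u → (∀ y → WayBelow y x → y ≤ u) → x ≤ u))

  IsWpo : Set
  IsWpo = ∀ (s : ℕ → X) → ∃₂ λ i j → i < j × s i ≤ s j

  UpClosed : (X → Set) → Set
  UpClosed U = ∀ x y → x ≤ y → U x → U y

  ScottOpen : (X → Set) → Set₁
  ScottOpen U = UpClosed U
              × (∀ (D : X → Set) → Directed D → ∀ l → IsLub D l → U l
                 → ∃ λ x → D x × U x)

  ScottClosed : (X → Set) → Set₁
  ScottClosed C = ∃ λ (U : X → Set) → ScottOpen U × (∀ x → C x ⇔ (¬ U x))

  cl : ∀ {ℓ} → (X → Set ℓ) → X → Set (lsuc 0ℓ ⊔ ℓ)
  cl A x = ∀ (C : X → Set) → ScottClosed C → (∀ y → A y → C y) → C x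

ScottContinuous : ∀ {X Y : Set} (_≤X_ : X → X → Set) (_≤Y_ : Y → Y → Set)
                  → (X → Y) → Set₁
ScottContinuous _≤X_ _≤Y_ φ =
  ∀ (U : _ → Set) → ScottOpen _≤Y_ U → ScottOpen _≤X_ (λ x → U (φ x))

Image : ∀ {ℓ} {X Y : Set} → (X → Y) → (X → Set ℓ) → Y → Set ℓ
Image φ B y = ∃ λ x → B x × φ x ≡ y

_⊆_ : ∀ {ℓ₁ ℓ₂} {X : Set} → (X → Set ℓ₁) → (X → Set ℓ₂) → Set (ℓ₁ ⊔ ℓ₂)
A ⊆ B = ∀ x → A x → B x

_≐_ : ∀ {ℓ₁ ℓ₂} {X : Set} → (X → Set ℓ₁) → (X → Set ℓ₂) → Set (ℓ₁ ⊔ ℓ₂)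
A ≐ B = (A ⊆ B) × (B ⊆ A)

record PartialMap (X : Set) : Set₁ where
  field
    dom : X → Set
    app : (x : X) → dom x → X
open PartialMap public

module _ {X : Set} (_≤_ : X → X → Set) where

  PartialContinuous : PartialMap X → Set₁
  PartialContinuous f =
    ScottOpen _≤_ (dom f)
    × (∀ (D : X → Set) (sub : ∀ x → D x → dom f x) → Directed _≤_ D
       → ∀ l → IsLub _≤_ D l → (p : dom f l)
       → IsLub _≤_ (λ y → ∃ λ x → Σ (D x) λ d → y ≡ app f x (sub x d)) (app f l p))

module _ {X : Set} {n : ℕ} (maps : Fin n → PartialMap X) where

  -- Run x w y : the word w ∈ F* (letters applied left to right, so the
  -- word fg denotes g ∘ f) is defined on x and maps x to y
  data Run : X → List (Fin n) → X → Set where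
    nil  : ∀ {x} → Run x [] x
    cons : ∀ {x f w y} (p : dom (maps f) x)
         → Run (app (maps f) x p) w y → Run x (f ∷ w) y

  InDom : List (Fin n) → X → Set
  InDom w x = ∃ λ y → Run x w y

  PostL : List X → X → Set
  PostL A y = ∃ λ f → ∃ λ a → a ∈ₗ A × Σ (dom (maps f) a) λ p → y ≡ app (maps f) a p

  module _ (_≤_ : X → X → Set) where

    Cover : X → X → Set
    Cover s₀ x = ∃ λ a → a ≤ s₀ × ∃ λ w → ∃ λ y → Run a w y × x ≤ y

    Iter : List (Fin n) → X → X → Set
    Iter g x z = ∃ λ k → Run x (concat (replicate k g)) z

    LubAcc : List (Fin n) → X → X → Set
    LubAcc g x y = ∃ λ gx → Run x g gx ×
      ( ((x ≤ gx × x ≢ gx) × IsLub _≤_ (Iter g x) y)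
      ⊎ (¬ (x ≤ gx × x ≢ gx) × y ≡ gx))

    PostLeqFlat : List X → Set
    PostLeqFlat A = ∀ x → (∃ λ y → PostL A y × x ≤ y) → ∃ λ b → b ∈ₗ A × x ≤ b

record OTS : Set₁ where
  field
    State  : Set
    _≤_    : State → State → Set
    isPO   : IsPartialOrder _≡_ _≤_
    nF     : ℕ
    trans  : Fin nF → PartialMap State
open OTS public

record IsComplete (T : OTS) : Set₁ where
  field
    dcpo       : IsDcpo (_≤_ T)
    continuous : IsContinuous (_≤_ T)
    wpo        : IsWpo (_≤_ T)
    pcont      : ∀ f → PartialContinuous (_≤_ T) (trans T f)

record Effective (T : OTS) : Set₁ where
  field
    code    : ℕ → State T
    surj    : ∀ s → ∃ λ m → code m ≡ s
    dec≤    : ∀ m k → Dec (_≤_ T (code m) (code k))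
    decDom  : ∀ f m → Dec (dom (trans T f) (code m))
    compute : ∀ f → ∃ λ (c : ℕ → ℕ) →
                ∀ m (p : dom (trans T f) (code m)) → code (c m) ≡ app (trans T f) (code m) p
open Effective public

record InfEffective (T : OTS) : Set₁ where
  field
    effective : Effective T
    computeAcc : ∀ (g : List (Fin (nF T))) → ∃ λ (c : ℕ → ℕ) →
      ∀ m → InDom (trans T) g (code effective m)
          → LubAcc (trans T) (_≤_ T) g (code effective m) (code effective (c m))
open InfEffective public

data InStar {A : Set} (w : List A) : List A → Set where
  none : InStar w []
  more : ∀ {u} → InStar w u → InStar w (w ++ u)

data InStars {A : Set} : List (List A) → List A → Set where
  done : InStars [] []
  next : ∀ {w ws u v t} → InStar w u → InStars ws v → t ≡ u ++ v → InStars (w ∷ ws) t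

Flat : (T : OTS) → State T → Set
Flat T s₁ = ∃ λ (ws : List (List (Fin (nF T)))) →
  ∀ w → InDom (trans T) w s₁ → InStars ws w

record Flattening (T₂ : OTS) : Set₁ where
  field
    T₁  : OTS
    φ   : State T₁ → State T₂
    φF  : Fin (nF T₁) → Fin (nF T₂)
    hom : ∀ f s (p : dom (trans T₁ f) s) →
            Σ (dom (trans T₂ (φF f)) (φ s)) λ q →
              φ (app (trans T₁ f) s p) ≡ app (trans T₂ (φF f)) (φ s) q
open Flattening public

ContinuousFlattening : ∀ {T₂} → Flattening T₂ → Set₁
ContinuousFlattening {T₂} fl =
  IsComplete (T₁ fl) × ScottContinuous (_≤_ (T₁ fl)) (_≤_ T₂) (φ fl)

CoverOf : (T : OTS) → State T → State T → Set
CoverOf T = Cover (trans T) (_≤_ T)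

clOf : ∀ {ℓ} (T : OTS) → (State T → Set ℓ) → State T → Set (lsuc 0ℓ ⊔ ℓ)
clOf T = cl (_≤_ T)

FlatCl : ∀ {T} (fl : Flattening T) → State (T₁ fl) → State T → Set₁
FlatCl {T} fl s₁ = clOf T (Image (φ fl) (clOf (T₁ fl) (CoverOf (T₁ fl) s₁)))

CloverFlattable : (T : OTS) → State T → Set₁
CloverFlattable T s₀ = ∃ λ (fl : Flattening T) → ∃ λ (s₁ : State (T₁ fl)) →
  ContinuousFlattening fl × Flat (T₁ fl) s₁ × φ fl s₁ ≡ s₀
  × (clOf T (CoverOf T s₀) ≐ FlatCl fl s₁)

WeaklyCloverFlattable : (T : OTS) → State T → Set₁
WeaklyCloverFlattable T s₀ = ∃ λ (fl : Flattening T) → ∃ λ (s₁ : State (T₁ fl)) →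
  ContinuousFlattening fl × Flat (T₁ fl) s₁ × _≤_ T (φ fl s₁) s₀
  × (clOf T (CoverOf T s₀) ⊆ FlatCl fl s₁)

δ* : ∀ {n nQ} → (Fin nQ → Fin n → Maybe (Fin nQ)) → Fin nQ → List (Fin n) → Maybe (Fin nQ)
δ* δ q [] = just q
δ* δ q (f ∷ w) with δ q f
... | nothing = nothing
... | just q' = δ* δ q' w

Pfx : ∀ {A : Set} → (List A → Set) → List A → Set
Pfx L u = ∃ λ v → L (u ++ v)

record RLAutomaton (n : ℕ) : Set where
  field
    nQ : ℕ
    δ  : Fin nQ → Fin n → Maybe (Fin nQ)
    q₀ : Fin nQ
    ws : List (List (Fin n))
    -- all states final; recognized language = Pfx(w₁* ⋯ wₖ*)
    recog : ∀ u → (∃ λ q → δ* δ q₀ u ≡ just q) ⇔ Pfx (InStars ws) u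
open RLAutomaton public

module _ (T : OTS) (𝒜 : RLAutomaton (nF T)) where

  ProdState : Set
  ProdState = State T × Fin (nQ 𝒜)

  _≤×_ : ProdState → ProdState → Set
  (s , q) ≤× (s' , q') = _≤_ T s s' × q ≡ q'

  prodMap : Fin (nF T) → PartialMap ProdState
  prodMap f = record
    { dom = λ { (s , q) → dom (trans T f) s × ∃ λ q' → δ 𝒜 q f ≡ just q' }
    ; app = λ { (s , q) (p , q' , _) → (app (trans T f) s p , q') }
    }

  ProdCover : ProdState → ProdState → Set
  ProdCover = Cover prodMap _≤×_

StronglyCloverFlattable : (T : OTS) → State T → Set₁
StronglyCloverFlattable T s₀ = ∃ λ (𝒜 : RLAutomaton (nF T)) →
  clOf T (CoverOf T s₀)
  ≐ clOf T (Image proj₁ (cl (_≤×_ T 𝒜) (ProdCover T 𝒜 (s₀ , q₀ 𝒜))))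

module _ (T : OTS) (s₀ : State T) where

  -- the choices made by the loop: at iteration m the pair (g m , a m) is
  -- chosen and y m = (g m)^∞(a m) is added
  record Choices : Set where
    field
      g : ℕ → List (Fin (nF T))
      a : ℕ → State T
      y : ℕ → State T

  Aₘ : Choices → ℕ → List (State T)
  Aₘ c zero = [ s₀ ]
  Aₘ c (suc m) = Aₘ c m ++ [ Choices.y c m ]

  ValidChoices : Choices → Set
  ValidChoices c = ∀ m →
    Choices.a c m ∈ₗ Aₘ c m
    × InDom (trans T) (Choices.g c m) (Choices.a c m)
    × LubAcc (trans T) (_≤_ T) (Choices.g c m) (Choices.a c m) (Choices.y c m)

  FairChoices : Choices → Set
  FairChoices c = ∀ m (h : List (Fin (nF T))) (b : State T) →
    b ∈ₗ Aₘ c m → InDom (trans T) h b →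
    ∃ λ k → m ≤ℕ k × Choices.g c k ≡ h × Choices.a c k ≡ b

  -- the procedure terminates on s₀: every fair execution reaches an
  -- iteration m at which the loop guard Post(A) ≤♭ A holds
  CloverTerminates : Set
  CloverTerminates = ∀ (c : Choices) → ValidChoices c → FairChoices c →
    ∃ λ m → PostLeqFlat (trans T) (_≤_ T) (Aₘ c m)

{-# OPTIONS --safe #-}
module Submission where

-- Weak flattability forces termination: along the words w₁, …, wₖ of the flattening, the wpo
-- property yields i < j with wⁱ(a) ≤ wʲ(a), and then either the orbit of a repeats or
-- one or two accelerations dominate its tail, so finitely many fairly chosen pairs dominate
-- w₁* ⋯ wₖ*(s₀).  Conversely the words g₀, …, gₘ₋₁ picked by one terminating fair execution
-- give the language g₀* ⋯ gₘ₋₁* of an rl-automaton, and the synchronized product with an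
-- rl-automaton is a continuous flattening.
--
-- Constructively, ↓A is not known to be Scott-closed for finite A.  The loop guard is
-- decidable, however, so only the double negation of this is needed, and it does follow from
-- the hypotheses (¬¬-complement-open).

open import Defs
open import Data.Bool using (if_then_else_)
open import Data.Empty using (⊥-elim)
open import Data.Fin using (Fin; zero; suc; toℕ; fromℕ<; funToFin; finToFun)
import Data.Fin.Properties as Fin
open import Data.Fin.Properties using (any?; toℕ<n; fromℕ<-toℕ; finToFun-funToFin)
open import Data.List using (List; []; _∷_; _++_; [_]; concat; concatMap; replicate; map; mapMaybe; inits; tails; length; lookup)
open import Data.List.Membership.Propositional using (_∈_; find; lose)
open import Data.List.Membership.Propositional.Properties using (∈-++⁺ˡ; ∈-++⁺ʳ; ∈-++⁻; ∈-map⁺; ∈-map⁻; ∈-lookup)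
open import Data.List.Properties using (++-assoc; ++-identityʳ; ∷-injective; ≡-dec; map-++)
import Data.List.Relation.Unary.Any as Any
open import Data.List.Relation.Unary.Any using (here; there; index)
open import Data.List.Relation.Unary.Any.Properties using (lookup-index)
open import Data.Maybe using (Maybe; just; nothing)
open import Data.Maybe.Properties using (just-injective)
open import Data.Nat using (ℕ; zero; suc; _+_; _*_; _^_; _<_; _<?_; z≤n; s≤s; NonZero) renaming (_≤_ to _≤ℕ_)
open import Data.Nat.DivMod using (_/_; _%_; m≡m%n+[m/n]*n; m%n<n)
open import Data.Nat.Induction using (<-rec)
import Data.Nat.Properties as ℕ
open import Data.Product using (Σ; ∃; ∃₂; _×_; _,_; proj₁; proj₂)
import Data.Product.Properties as ×
open import Data.Sum using (_⊎_; inj₁; inj₂)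
open import Function.Bundles using (_⇔_; mk⇔; Equivalence)
open import Relation.Binary.Definitions using (DecidableEquality)
open import Relation.Binary.PropositionalEquality using (_≡_; _≢_; refl; sym; cong; cong₂; subst; subst₂; isEquivalence) renaming (trans to ≡-trans)
open import Relation.Binary.Structures using (IsPartialOrder)
open import Relation.Nullary using (¬_; Dec; yes; no; does)
open import Relation.Nullary.Decidable using (_×-dec_; map′; decidable-stable)
open Equivalence using (to; from)

-- Words, powers and bounded languages w₁* ⋯ wₖ*

module Words {A : Set} where

  pow : List A → ℕ → List A
  pow w n = concat (replicate n w)

  pow-+ : ∀ w m n → pow w (m + n) ≡ pow w m ++ pow w n
  pow-+ w zero n = refl
  pow-+ w (suc m) n = ≡-trans (cong (w ++_) (pow-+ w m n)) (sym (++-assoc w _ _))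

  pow-* : ∀ w k p → pow (pow w p) k ≡ pow w (k * p)
  pow-* w zero p = refl
  pow-* w (suc k) p = ≡-trans (cong (pow w p ++_) (pow-* w k p)) (sym (pow-+ w p (k * p)))

  pow-1 : ∀ w → pow w 1 ≡ w
  pow-1 = ++-identityʳ

  InStar⇒pow : ∀ {w u} → InStar w u → ∃ λ n → u ≡ pow w n
  InStar⇒pow none = 0 , refl
  InStar⇒pow {w} (more s) with InStar⇒pow s
  ... | n , refl = suc n , refl

  InStar-pow : ∀ w n → InStar w (pow w n)
  InStar-pow w zero = none
  InStar-pow w (suc n) = more (InStar-pow w n)

  InStars-[] : ∀ ws → InStars ws ([] {A = A})
  InStars-[] [] = done
  InStars-[] (w ∷ ws) = next none (InStars-[] ws) refl

  InStars-++ : ∀ {vs ws u v} → InStars {A} vs u → InStars ws v → InStars (vs ++ ws) (u ++ v)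
  InStars-++ done r = r
  InStars-++ {v = v} (next {u = a} {v = b} s t refl) r =
    next s (InStars-++ t r) (++-assoc a b v)

  InStars-∈ : ∀ {w ws} → w ∈ ws → InStars {A} ws w
  InStars-∈ {w} (here refl) = next (more none) (InStars-[] _) (sym (≡-trans (++-identityʳ _) (++-identityʳ w)))
  InStars-∈ (there i) = next none (InStars-∈ i) refl

  ++-split : ∀ (u v s t : List A) → u ++ v ≡ s ++ t →
    (∃ λ r → u ++ r ≡ s) ⊎ (∃ λ r → u ≡ s ++ r × r ++ v ≡ t)
  ++-split u v [] t eq = inj₂ (u , refl , eq)
  ++-split [] v (x ∷ s) t eq = inj₁ (x ∷ s , refl)
  ++-split (x ∷ u) v (y ∷ s) t eq with ∷-injective eq
  ... | refl , eq' with ++-split u v s t eq'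
  ...   | inj₁ (r , e) = inj₁ (r , cong (x ∷_) e)
  ...   | inj₂ (r , e , e') = inj₂ (r , cong (x ∷_) e , e')

  prefix⇒∈inits : ∀ (u v : List A) → u ∈ inits (u ++ v)
  prefix⇒∈inits [] v = here refl
  prefix⇒∈inits (x ∷ u) v = there (∈-map⁺ (x ∷_) (prefix⇒∈inits u v))

  Pfx-InStar : ∀ {w t} u v → InStar w t → u ++ v ≡ t →
    ∃₂ λ s p → InStar w s × p ∈ inits w × u ≡ s ++ p
  Pfx-InStar [] v s eq = [] , [] , none , here refl , refl
  Pfx-InStar (x ∷ u) v none ()
  Pfx-InStar {w} u@(_ ∷ _) v (more {t} i) eq with ++-split u v w t eq
  ... | inj₁ (r , refl) = [] , u , none , prefix⇒∈inits u r , refl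
  ... | inj₂ (r , u≡ , e) with Pfx-InStar r v i e
  ...   | s , p , j , p∈ , refl = w ++ s , p , more j , p∈ , ≡-trans u≡ (sym (++-assoc w s p))

  -- Flatness asks for a language v₁* ⋯ vₗ*, whereas an rl-automaton accepts prefixes. A prefix
  -- stops inside some wᵢ, so each wᵢ is followed by its own prefixes as further starred words, at
  -- most one of which is used, and once.
  withPrefixes : List (List A) → List (List A)
  withPrefixes = concatMap (λ w → w ∷ inits w)

  Pfx-InStars : ∀ ws u → Pfx (InStars ws) u → InStars (withPrefixes ws) u
  Pfx-InStars [] [] (v , i) = done
  Pfx-InStars (w ∷ ws) u (v , next {u = s} {v = t} i j eq) with ++-split u v s t eq
  ... | inj₁ (r , e) with Pfx-InStar u r i e
  ...   | s' , p , i' , p∈ , refl =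
    subst (InStars _) (cong (s' ++_) (++-identityʳ p))
      (next i' (InStars-++ (InStars-∈ p∈) (InStars-[] (withPrefixes ws))) refl)
  Pfx-InStars (w ∷ ws) u (v , next {u = s} {v = t} i j eq) | inj₂ (r , refl , e) =
    next i (InStars-++ (InStars-[] (inits w)) (Pfx-InStars ws r (v , subst (InStars ws) (sym e) j))) refl

open Words

-- A nondeterministic automaton for the prefixes of w₁* ⋯ wₖ*

-- The position (r , vs) stands for the residual language r · v₁* ⋯ vₖ* with vs = v₁ … vₖ.
module PositionAutomaton {A : Set} where

  Position : Set
  Position = List A × List (List A)

  -- No step is silent: `skip` absorbs the moves past starred words into the next letter, and
  -- `enter` loops on nonempty words only.
  data Step : Position → A → Position → Set where
    letter : ∀ {f r vs} → Step (f ∷ r , vs) f (r , vs)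
    enter  : ∀ {f r vs} → Step ([] , (f ∷ r) ∷ vs) f (r , (f ∷ r) ∷ vs)
    skip   : ∀ {f v vs p} → Step ([] , vs) f p → Step ([] , v ∷ vs) f p

  data Path : Position → List A → Set where
    []  : ∀ {p} → Path p []
    _∷_ : ∀ {p q f u} → Step p f q → Path q u → Path p (f ∷ u)

  Residual : Position → List A → Set
  Residual (r , vs) t = ∃ λ t' → InStars vs t' × t ≡ r ++ t'

  Step-Residual : ∀ {p f q t} → Step p f q → Residual q t → Residual p (f ∷ t)
  Step-Residual letter (t' , i , refl) = t' , i , refl
  Step-Residual {f = f} (enter {r = r}) (t' , next {u = u} {v = v} i j refl , refl) =
    _ , next (more i) j (cong (f ∷_) (sym (++-assoc r u v))) , refl
  Step-Residual (skip s) r with Step-Residual s r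
  ... | t' , i , refl = t' , next none i refl , refl

  InStars-Step : ∀ {vs f t} → InStars vs (f ∷ t) → ∃ λ q → Step ([] , vs) f q × Residual q t
  InStars-Step (next none j refl) with InStars-Step j
  ... | q , s , r = q , skip s , r
  -- An iteration of the empty word contributes no letter; dropping it shortens the derivation.
  InStars-Step (next {w = []} (more i) j eq) = InStars-Step (next i j eq)
  InStars-Step (next {w = x ∷ r} (more {u} i) j eq) with ∷-injective eq
  ... | refl , refl = _ , enter , _ , next i j refl , ++-assoc r u _

  Residual-Step : ∀ {p f t} → Residual p (f ∷ t) → ∃ λ q → Step p f q × Residual q t
  Residual-Step {[] , vs} (_ , i , refl) = InStars-Step i
  Residual-Step {x ∷ r , vs} (t' , i , refl) = _ , letter , t' , i , refl

  -- Every position can be completed, by finishing its pending word and iterating nothing more, so a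
  -- path may stop anywhere and still spell a prefix.
  Path⇒Pfx : ∀ {p u} → Path p u → Pfx (Residual p) u
  Path⇒Pfx {r , vs} [] = _ , _ , InStars-[] vs , refl
  Path⇒Pfx (s ∷ π) with Path⇒Pfx π
  ... | v , res = v , Step-Residual s res

  Pfx⇒Path : ∀ p u → Pfx (Residual p) u → Path p u
  Pfx⇒Path p [] _ = []
  Pfx⇒Path p (f ∷ u) (v , res) with Residual-Step res
  ... | q , s , res' = s ∷ Pfx⇒Path q u (v , res')

  -- What remains of the current starred word is one of its suffixes, so this finite list is closed
  -- under `Step`.
  positions : List (List A) → List Position
  positions [] = [ ([] , []) ]
  positions (w ∷ ws) = map (_, w ∷ ws) (tails w) ++ positions ws

  start∈positions : ∀ ws → ([] , ws) ∈ positions ws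
  start∈positions [] = here refl
  start∈positions (w ∷ ws) = ∈-++⁺ˡ (∈-map⁺ (_, w ∷ ws) ([]∈tails w))
    where
    []∈tails : (w : List A) → [] ∈ tails w
    []∈tails [] = here refl
    []∈tails (x ∷ w) = there ([]∈tails w)

  tails-tail : ∀ {f} {r : List A} w → (f ∷ r) ∈ tails w → r ∈ tails w
  tails-tail [] (here ())
  tails-tail [] (there ())
  tails-tail (x ∷ w) (here refl) = there (here refl)
  tails-tail (x ∷ w) (there i) = there (tails-tail w i)

  Step-start-∈positions : ∀ ws {f q} → Step ([] , ws) f q → q ∈ positions ws
  Step-start-∈positions ((f ∷ r) ∷ ws) enter = ∈-++⁺ˡ (∈-map⁺ (_, (f ∷ r) ∷ ws) (tails-tail (f ∷ r) (here refl)))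
  Step-start-∈positions (w ∷ ws) (skip s) = ∈-++⁺ʳ _ (Step-start-∈positions ws s)

  Step-∈positions : ∀ ws {p f q} → p ∈ positions ws → Step p f q → q ∈ positions ws
  Step-∈positions [] (here refl) ()
  Step-∈positions (w ∷ ws) p∈ s with ∈-++⁻ (map (_, w ∷ ws) (tails w)) p∈
  ... | inj₂ i = ∈-++⁺ʳ _ (Step-∈positions ws i s)
  ... | inj₁ i with ∈-map⁻ (_, w ∷ ws) i
  Step-∈positions (w ∷ ws) p∈ letter | inj₁ i | _ , j , refl =
    ∈-++⁺ˡ (∈-map⁺ (_, w ∷ ws) (tails-tail w j))
  Step-∈positions (w ∷ ws) p∈ enter | inj₁ i | _ , j , refl = Step-start-∈positions (w ∷ ws) enter
  Step-∈positions (w ∷ ws) p∈ (skip s) | inj₁ i | _ , j , refl = Step-start-∈positions (w ∷ ws) (skip s)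

  module _ (_≟_ : DecidableEquality A) where

    _≟ₚ_ : DecidableEquality Position
    _≟ₚ_ = ×.≡-dec (≡-dec _≟_) (≡-dec (≡-dec _≟_))

    step? : ∀ p f q → Dec (Step p f q)
    step? (x ∷ r , vs) f q with x ≟ f | q ≟ₚ (r , vs)
    ... | yes refl | yes refl = yes letter
    ... | no x≢f | _ = no λ { letter → x≢f refl }
    ... | _ | no q≢ = no λ { letter → q≢ refl }
    step? ([] , []) f q = no λ ()
    step? ([] , [] ∷ vs) f q = map′ skip (λ { (skip s) → s }) (step? ([] , vs) f q)
    step? ([] , (x ∷ r) ∷ vs) f q with step? ([] , vs) f q
    ... | yes s = yes (skip s)
    ... | no ¬s with x ≟ f | q ≟ₚ (r , (x ∷ r) ∷ vs)
    ...   | yes refl | yes refl = yes enter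
    ...   | no x≢f | _ = no λ { enter → x≢f refl ; (skip s) → ¬s s }
    ...   | _ | no q≢ = no λ { enter → q≢ refl ; (skip s) → ¬s s }

-- Determinization into an rl-automaton

module SubsetConstruction {n : ℕ} (ws : List (List (Fin n))) where

  open PositionAutomaton {Fin n}

  private
    N : ℕ
    N = length (positions ws)

    at : Fin N → Position
    at = lookup (positions ws)

  -- The states of an rl-automaton form a `Fin`, so a subset of positions is coded by its
  -- characteristic function, itself a number below 2 ^ N.
  _∈ₛ_ : Fin N → Fin (2 ^ N) → Set
  i ∈ₛ S = finToFun S i ≡ suc zero

  toSubset : {P : Fin N → Set} → (∀ i → Dec (P i)) → Fin (2 ^ N)
  toSubset P? = funToFin (λ i → if does (P? i) then suc zero else zero)

  ∈-toSubset : {P : Fin N → Set} (P? : ∀ i → Dec (P i)) → ∀ i → i ∈ₛ toSubset P? ⇔ P i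
  ∈-toSubset P? i
    rewrite finToFun-funToFin {N} {2} (λ i → if does (P? i) then suc zero else zero) i with P? i
  ... | yes p = mk⇔ (λ _ → p) (λ _ → refl)
  ... | no ¬p = mk⇔ (λ ()) (λ p → ⊥-elim (¬p p))

  Succ : Fin (2 ^ N) → Fin n → Fin N → Set
  Succ S f j = ∃ λ i → i ∈ₛ S × Step (at i) f (at j)

  succ? : ∀ S f j → Dec (Succ S f j)
  succ? S f j = any? λ i → (finToFun S i Fin.≟ suc zero) ×-dec step? Fin._≟_ (at i) f (at j)

  -- All states are final, so rejection has to be undefinedness: a transition to the empty subset is
  -- left out.
  subsetδ : Fin (2 ^ N) → Fin n → Maybe (Fin (2 ^ N))
  subsetδ S f with any? (succ? S f)
  ... | yes _ = just (toSubset (succ? S f))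
  ... | no  _ = nothing

  subsetδ-just : ∀ {S f S'} → subsetδ S f ≡ just S' →
    (∃ λ j → j ∈ₛ S') × (∀ j → j ∈ₛ S' ⇔ Succ S f j)
  subsetδ-just {S} {f} eq with any? (succ? S f)
  subsetδ-just {S} {f} refl | yes (j , s) =
    (j , from (∈-toSubset (succ? S f) j) s) , ∈-toSubset (succ? S f)

  subsetδ-defined : ∀ {S f j} → Succ S f j → ∃ λ S' → subsetδ S f ≡ just S'
  subsetδ-defined {S} {f} {j} s with any? (succ? S f)
  ... | yes _ = _ , refl
  ... | no ¬s = ⊥-elim (¬s (j , s))

  δ*⇒Path : ∀ S u → (∃ λ i → i ∈ₛ S) → (∃ λ S' → δ* subsetδ S u ≡ just S') →
    ∃ λ i → i ∈ₛ S × Path (at i) u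
  δ*⇒Path S [] (i , i∈) _ = i , i∈ , []
  δ*⇒Path S (f ∷ u) _ d with subsetδ S f in eq
  ... | just S' with subsetδ-just eq
  ...   | ne , mem with δ*⇒Path S' u ne d
  ...     | j , j∈ , π with to (mem j) j∈
  ...       | i , i∈ , s = i , i∈ , s ∷ π

  Path⇒δ* : ∀ S u i → i ∈ₛ S → Path (at i) u → ∃ λ S' → δ* subsetδ S u ≡ just S'
  Path⇒δ* S [] i i∈ [] = S , refl
  Path⇒δ* S (f ∷ u) i i∈ (s ∷ π) with Step-∈positions ws (∈-lookup i) s
  ... | q∈ with lookup-index q∈
  ...   | at-j rewrite at-j with subsetδ-defined {S} {f} {index q∈} (i , i∈ , s)
  ...     | S' , eq rewrite eq =
    Path⇒δ* S' u (index q∈) (from (proj₂ (subsetδ-just eq) _) (i , i∈ , s)) π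

  startIndex : Fin N
  startIndex = index (start∈positions ws)

  start? : ∀ i → Dec (i ≡ startIndex)
  start? i = i Fin.≟ startIndex

  starAutomaton : RLAutomaton n
  starAutomaton = record
    { nQ = 2 ^ N
    ; δ = subsetδ
    ; q₀ = toSubset start?
    ; ws = ws
    ; recog = λ u → mk⇔ (sound u) (complete u)
    }
    where
    at-start : ([] , ws) ≡ at startIndex
    at-start = lookup-index (start∈positions ws)

    sound : ∀ u → (∃ λ q → δ* subsetδ (toSubset start?) u ≡ just q) → Pfx (InStars ws) u
    sound u d with δ*⇒Path _ u (_ , from (∈-toSubset start? startIndex) refl) d
    ... | i , i∈ , π with to (∈-toSubset start? i) i∈
    ...   | refl with Path⇒Pfx (subst (λ p → Path p u) (sym at-start) π)
    ...     | v , t , j , eq = v , subst (InStars ws) (sym eq) j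

    complete : ∀ u → Pfx (InStars ws) u → ∃ λ q → δ* subsetδ (toSubset start?) u ≡ just q
    complete u (v , j) = Path⇒δ* _ u startIndex (from (∈-toSubset start? startIndex) refl)
      (subst (λ p → Path p u) at-start (Pfx⇒Path _ u (v , _ , j , refl)))

-- Products of a well partial order with a finite set

module WpoProduct {S : Set} (_≤_ : S → S → Set) (wpo : IsWpo _≤_) where

  Good : ∀ {k} → (ℕ → S × Fin k) → Set
  Good s = ∃₂ λ i j → i < j × proj₁ (s i) ≤ proj₁ (s j) × proj₂ (s i) ≡ proj₂ (s j)

  -- Either a good pair shows up or colour zero occurs arbitrarily late, so that the
  -- wpo property applies to the zero-coloured subsequence; no search is unbounded.
  wpo-×-Fin : ∀ k (s : ℕ → S × Fin k) → Good s
  wpo-×-Fin zero s with proj₂ (s 0)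
  ... | ()
  wpo-×-Fin (suc k) s = good
    where
    zero-after : ∀ N → Good s ⊎ ∃ λ m → N ≤ℕ m × proj₂ (s m) ≡ zero
    zero-after N with proj₂ (s N) in eqN
    ... | zero = inj₂ (N , ℕ.≤-refl , eqN)
    ... | suc c₀ = finish (wpo-×-Fin k (λ n → drop (s (N + n))))
      where
      -- Past `N`, colour zero is replaced by the arbitrary colour `c₀`, which leaves `k` colours
      -- for the induction. A good pair that involves a replaced colour exhibits a late zero
      -- instead.
      drop : S × Fin (suc k) → S × Fin k
      drop (x , zero) = x , c₀
      drop (x , suc c) = x , c

      finish : Good (λ n → drop (s (N + n))) → Good s ⊎ ∃ λ m → N ≤ℕ m × proj₂ (s m) ≡ zero
      finish (i , j , i<j , x≤y , c≡d) with s (N + i) in eqi | s (N + j) in eqj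
      ... | _ , zero | _ = inj₂ (N + i , ℕ.m≤m+n N i , cong proj₂ eqi)
      ... | _ , suc _ | _ , zero = inj₂ (N + j , ℕ.m≤m+n N j , cong proj₂ eqj)
      ... | x , suc c | y , suc d = inj₁ (N + i , N + j , ℕ.+-monoʳ-< N i<j ,
        subst₂ _≤_ (sym (cong proj₁ eqi)) (sym (cong proj₁ eqj)) x≤y ,
        ≡-trans (cong proj₂ eqi) (≡-trans (cong suc c≡d) (sym (cong proj₂ eqj))))

    pick : ℕ → ℕ
    pick N with zero-after N
    -- A dummy value: here a good pair is already known.
    ... | inj₁ _ = N
    ... | inj₂ (m , _) = m

    N≤pick : ∀ N → N ≤ℕ pick N
    N≤pick N with zero-after N
    ... | inj₁ _ = ℕ.≤-refl
    ... | inj₂ (_ , N≤m , _) = N≤m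

    pick-zero : ∀ N → Good s ⊎ proj₂ (s (pick N)) ≡ zero
    pick-zero N with zero-after N
    ... | inj₁ g = inj₁ g
    ... | inj₂ (_ , _ , z) = inj₂ z

    start : ℕ → ℕ
    start zero = zero
    start (suc n) = suc (pick (start n))

    start-< : ∀ {i j} → i < j → pick (start i) < pick (start j)
    start-< {i} {suc j} (s≤s i≤j) with ℕ.m≤n⇒m<n∨m≡n i≤j
    ... | inj₁ i<j = ℕ.<-trans (start-< i<j) (N≤pick (start (suc j)))
    ... | inj₂ refl = N≤pick (start (suc j))

    good : Good s
    good with wpo (λ n → proj₁ (s (pick (start n))))
    ... | i , j , i<j , x≤y with pick-zero (start i) | pick-zero (start j)
    ...   | inj₁ g | _ = g
    ...   | _ | inj₁ g = g
    ...   | inj₂ zi | inj₂ zj = _ , _ , start-< i<j , x≤y , ≡-trans zi (sym zj)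

-- Enumeration of pairs of a word and a code, with infinite repetition

module Schedule {n : ℕ} where

  -- One step along the antidiagonals of ℕ × ℕ; its iterates from the origin invert Cantor's
  -- pairing.
  diagonalStep : ℕ × ℕ → ℕ × ℕ
  diagonalStep (zero , b) = suc b , zero
  diagonalStep (suc a , b) = a , suc b

  unpair : ℕ → ℕ × ℕ
  unpair zero = zero , zero
  unpair (suc k) = diagonalStep (unpair k)

  unpair-sum : ∀ k → proj₁ (unpair k) + proj₂ (unpair k) ≤ℕ k
  unpair-sum zero = z≤n
  unpair-sum (suc k) with unpair k | unpair-sum k
  ... | zero , b | b≤k rewrite ℕ.+-identityʳ b = s≤s b≤k
  ... | suc a , b | a+b<k rewrite ℕ.+-suc a b = ℕ.m≤n⇒m≤1+n a+b<k

  unpair-surjective : ∀ a b → ∃ λ k → unpair k ≡ (a , b)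
  unpair-surjective a b = go (a + b) b a refl
    where
    go : ∀ s b a → a + b ≡ s → ∃ λ k → unpair k ≡ (a , b)
    go s zero zero _ = 0 , refl
    go (suc s) zero (suc a) eq with go s a zero (≡-trans (sym (ℕ.+-identityʳ a)) (ℕ.suc-injective eq))
    ... | k , e = suc k , cong diagonalStep e
    go s (suc b) a eq with go s b (suc a) (≡-trans (sym (ℕ.+-suc a b)) eq)
    ... | k , e = suc k , cong diagonalStep e

  toFin : ℕ → Maybe (Fin n)
  toFin m with m <? n
  ... | yes m<n = just (fromℕ< m<n)
  ... | no _ = nothing

  decodeLetters : ℕ → ℕ → List ℕ
  decodeLetters zero c = []
  decodeLetters (suc l) c = proj₁ (unpair c) ∷ decodeLetters l (proj₂ (unpair c))

  decodeLetters-surjective : ∀ xs → ∃ λ c → decodeLetters (length xs) c ≡ xs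
  decodeLetters-surjective [] = 0 , refl
  decodeLetters-surjective (x ∷ xs) with decodeLetters-surjective xs
  ... | c , e with unpair-surjective x c
  ...   | k , e' = k , cong₂ _∷_ (cong proj₁ e') (≡-trans (cong (λ p → decodeLetters (length xs) (proj₂ p)) e') e)

  decodeWord : ℕ → List (Fin n)
  decodeWord c = mapMaybe toFin (decodeLetters (proj₁ (unpair c)) (proj₂ (unpair c)))

  decodeWord-surjective : ∀ w → ∃ λ c → decodeWord c ≡ w
  decodeWord-surjective w with decodeLetters-surjective (map toℕ w)
  ... | c , e with unpair-surjective (length (map toℕ w)) c
  ...   | k , e' = k , ≡-trans (cong (λ p → mapMaybe toFin (decodeLetters (proj₁ p) (proj₂ p))) e')
                       (≡-trans (cong (mapMaybe toFin) e) (mapMaybe-toFin w))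
    where
    toFin-toℕ : ∀ i → toFin (toℕ i) ≡ just i
    toFin-toℕ i with toℕ i <? n
    ... | yes i<n = cong just (fromℕ<-toℕ i i<n)
    ... | no i≮n = ⊥-elim (i≮n (toℕ<n i))

    mapMaybe-toFin : ∀ w → mapMaybe toFin (map toℕ w) ≡ w
    mapMaybe-toFin [] = refl
    mapMaybe-toFin (i ∷ w) rewrite toFin-toℕ i = cong (i ∷_) (mapMaybe-toFin w)

  -- The first component of `unpair k` is discarded. It is padding that makes every pair recur:
  -- padding with m yields an index at least m, by `unpair-sum`.
  schedule : ℕ → List (Fin n) × ℕ
  schedule k = decodeWord (proj₁ (unpair c)) , proj₂ (unpair c)
    where c = proj₂ (unpair k)

  schedule-recurrent : ∀ m w e → ∃ λ k → m ≤ℕ k × schedule k ≡ (w , e)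
  schedule-recurrent m w e with decodeWord-surjective w
  ... | c , refl with unpair-surjective c e
  ...   | d , eq with unpair-surjective m d
  ...     | k , eq' = k , m≤k ,
      ≡-trans (cong (λ p → decodeWord (proj₁ (unpair (proj₂ p))) , proj₂ (unpair (proj₂ p))) eq')
            (cong (λ p → decodeWord (proj₁ p) , proj₂ p) eq)
    where
    m≤k : m ≤ℕ k
    m≤k = ℕ.≤-trans (subst (λ p → m ≤ℕ proj₁ p + proj₂ p) (sym eq') (ℕ.m≤m+n m d)) (unpair-sum k)

open SubsetConstruction using (starAutomaton)

-- Scott-closed sets

module _ {X : Set} {_≼_ : X → X → Set} {C : X → Set} where

  closed-down : ScottClosed _≼_ C → ∀ {x y} → x ≼ y → C y → C x
  closed-down (U , (up , _) , C⇔¬U) x≼y Cy = from (C⇔¬U _) λ Ux → to (C⇔¬U _) Cy (up _ _ x≼y Ux)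

  closed-lub : ScottClosed _≼_ C → ∀ {D l} → Directed _≼_ D → IsLub _≼_ D l → (∀ x → D x → C x) → C l
  closed-lub (U , (_ , meets) , C⇔¬U) dir lub D⊆C = from (C⇔¬U _) λ Ul →
    let x , Dx , Ux = meets _ dir _ lub Ul in to (C⇔¬U x) (D⊆C x Dx) Ux

preimage-closed : ∀ {X Y : Set} {_≤X_ : X → X → Set} {_≤Y_ : Y → Y → Set} {φ : X → Y} {C : Y → Set} →
  ScottContinuous _≤X_ _≤Y_ φ → ScottClosed _≤Y_ C → ScottClosed _≤X_ (λ x → C (φ x))
preimage-closed cont (U , U-open , C⇔¬U) = _ , cont U U-open , λ x → C⇔¬U _

-- Runs, accelerations and closed sets in a complete transition system

module System (T : OTS) (complete : IsComplete T) where

  open IsComplete complete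
  open IsPartialOrder (isPO T) public using () renaming (refl to ≤-refl; trans to ≤-trans; antisym to ≤-antisym)

  infix 4 _≼_
  _≼_ : State T → State T → Set
  _≼_ = _≤_ T

  Reach : State T → List (Fin (nF T)) → State T → Set
  Reach = Run (trans T)

  pair-directed : ∀ {x y} → x ≼ y → Directed _≼_ (λ z → z ≡ x ⊎ z ≡ y)
  pair-directed x≼y = (_ , inj₁ refl) , λ a b a∈ b∈ → _ , inj₂ refl , below a∈ , below b∈
    where
    below : ∀ {z} → _ → z ≼ _
    below (inj₁ refl) = x≼y
    below (inj₂ refl) = ≤-refl

  pair-lub : ∀ {x y} → x ≼ y → IsLub _≼_ (λ z → z ≡ x ⊎ z ≡ y) y
  pair-lub x≼y = (λ { _ (inj₁ refl) → x≼y ; _ (inj₂ refl) → ≤-refl }) , λ u ub → ub _ (inj₂ refl)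

  -- The pair x ≤ y is a directed set with lub y, and continuity turns f(y) into an upper bound of
  -- its image.
  app-mono : ∀ f {x y} → x ≼ y → (p : dom (trans T f) x) (q : dom (trans T f) y) →
    app (trans T f) x p ≼ app (trans T f) y q
  app-mono f x≼y p q =
    proj₁ (proj₂ (pcont f) _ (λ { _ (inj₁ refl) → p ; _ (inj₂ refl) → q })
             (pair-directed x≼y) _ (pair-lub x≼y) q)
      _ (_ , inj₁ refl , refl)

  -- `dom` need not be a proposition; monotonicity at x ≤ x compares the two values both ways.
  app-irrelevant : ∀ f {x} (p q : dom (trans T f) x) → app (trans T f) x p ≡ app (trans T f) x q
  app-irrelevant f p q = ≤-antisym (app-mono f ≤-refl p q) (app-mono f ≤-refl q p)

  dom-up : ∀ f {x y} → x ≼ y → dom (trans T f) x → dom (trans T f) y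
  dom-up f = proj₁ (proj₁ (pcont f)) _ _

  Run-mono : ∀ {x x' w y} → x ≼ x' → Reach x w y → ∃ λ y' → Reach x' w y' × y ≼ y'
  Run-mono x≼x' nil = _ , nil , x≼x'
  Run-mono x≼x' (cons {f = f} p r) with dom-up f x≼x' p
  ... | q with Run-mono (app-mono f x≼x' p q) r
  ...   | y' , r' , y≼y' = y' , cons q r' , y≼y'

  Run-det : ∀ {x w y z} → Reach x w y → Reach x w z → y ≡ z
  Run-det nil nil = refl
  Run-det (cons {f = f} p r) (cons q r') =
    Run-det r (subst (λ x → Reach x _ _) (app-irrelevant f q p) r')

  Run-++ : ∀ {x u y v z} → Reach x u y → Reach y v z → Reach x (u ++ v) z
  Run-++ nil r' = r'
  Run-++ (cons p r) r' = cons p (Run-++ r r')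

  Run-split : ∀ u {x v z} → Reach x (u ++ v) z → ∃ λ y → Reach x u y × Reach y v z
  Run-split [] r = _ , nil , r
  Run-split (f ∷ u) (cons p r) with Run-split u r
  ... | y , r₁ , r₂ = y , cons p r₁ , r₂

  Run-pow-split : ∀ w m n {x z} → Reach x (pow w (m + n)) z → ∃ λ y → Reach x (pow w m) y × Reach y (pow w n) z
  Run-pow-split w m n r = Run-split (pow w m) (subst (λ u → Reach _ u _) (pow-+ w m n) r)

  -- A directed `D` need not lie in the domain of f. Since the domain is open and contains the lub,
  -- the part of `D` inside it is still directed with the same lub, and continuity of f applies to
  -- that part.
  dom-preimage-open : ∀ f {V} → ScottOpen _≼_ V →
    ScottOpen _≼_ (λ x → Σ (dom (trans T f) x) λ p → V (app (trans T f) x p))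
  dom-preimage-open f {V} (V-up , V-meets) = up , meets
    where
    up : UpClosed _≼_ _
    up x y x≼y (p , v) = dom-up f x≼y p , V-up _ _ (app-mono f x≼y p _) v

    meets : ∀ D → Directed _≼_ D → ∀ l → IsLub _≼_ D l → _ → _
    meets D (ne , ub) l lub (p , v) with proj₂ (proj₁ (pcont f)) D (ne , ub) l lub p
    ... | d₀ , Dd₀ , q₀ = conclude (V-meets _ image-directed _ (proj₂ (pcont f) D' (λ _ → proj₂) D'-directed l D'-lub p) v)
      where
      D' : State T → Set
      D' x = D x × dom (trans T f) x

      D'-directed : Directed _≼_ D'
      D'-directed = (d₀ , Dd₀ , q₀) , λ { x y (Dx , px) (Dy , _) →
        let z , Dz , x≼z , y≼z = ub x y Dx Dy in z , (Dz , dom-up f x≼z px) , x≼z , y≼z }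

      D'-lub : IsLub _≼_ D' l
      D'-lub = (λ { x (Dx , _) → proj₁ lub x Dx }) , λ u u-ub → proj₂ lub u λ x Dx →
        let z , Dz , x≼z , d₀≼z = ub x d₀ Dx Dd₀ in ≤-trans x≼z (u-ub z (Dz , dom-up f d₀≼z q₀))

      image-directed : Directed _≼_ (λ y → ∃ λ x → Σ (D' x) λ d → y ≡ app (trans T f) x (proj₂ d))
      image-directed = (_ , d₀ , (Dd₀ , q₀) , refl) , λ { _ _ (x , d , refl) (y , e , refl) →
        let z , D'z , x≼z , y≼z = proj₂ D'-directed x y d e
        in _ , (z , D'z , refl) , app-mono f x≼z (proj₂ d) (proj₂ D'z) , app-mono f y≼z (proj₂ e) (proj₂ D'z) }

      conclude : (∃ λ y → (∃ λ x → Σ (D' x) λ d → y ≡ app (trans T f) x (proj₂ d)) × V y) → _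
      conclude (_ , (x , (Dx , px) , refl) , Vy) = x , Dx , px , Vy

  open-resp-⇔ : ∀ {U V} → (∀ x → U x ⇔ V x) → ScottOpen _≼_ U → ScottOpen _≼_ V
  open-resp-⇔ U⇔V (up , meets) =
    (λ x y x≼y v → to (U⇔V y) (up x y x≼y (from (U⇔V x) v))) ,
    λ D dir l lub v → let x , Dx , u = meets D dir l lub (from (U⇔V l) v) in x , Dx , to (U⇔V x) u

  Run-preimage-open : ∀ w {U} → ScottOpen _≼_ U → ScottOpen _≼_ (λ x → ∃ λ z → Reach x w z × U z)
  Run-preimage-open [] = open-resp-⇔ λ x → mk⇔ (λ u → x , nil , u) λ { (_ , nil , u) → u }
  Run-preimage-open (f ∷ w) U-open =
    open-resp-⇔ (λ x → mk⇔ (λ { (p , z , r , u) → z , cons p r , u }) λ { (z , cons p r , u) → p , z , r , u })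
      (dom-preimage-open f (Run-preimage-open w U-open))

  -- The complement is a union, over the words of `W`, of open preimages.
  Run-preimage-closed : ∀ (W : List (Fin (nF T)) → Set) {C} → ScottClosed _≼_ C →
    ScottClosed _≼_ (λ x → ∀ w z → W w → Reach x w z → C z)
  Run-preimage-closed W (U , U-open , C⇔¬U) =
    (λ x → ∃ λ w → W w × ∃ λ z → Reach x w z × U z) ,
    ((λ { x y x≼y (w , Ww , h) → w , Ww , proj₁ (Run-preimage-open w U-open) x y x≼y h }) ,
     λ { D dir l lub (w , Ww , h) →
       let x , Dx , h' = proj₂ (Run-preimage-open w U-open) D dir l lub h in x , Dx , w , Ww , h' }) ,
    λ x → mk⇔ (λ { c (w , Ww , z , r , u) → to (C⇔¬U z) (c w z Ww r) u })
              (λ ¬u w z Ww r → from (C⇔¬U z) λ u → ¬u (w , Ww , z , r , u))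

  -- By monotonicity, x ≤ g(x) propagates to z ≤ g(z) along the whole orbit, and with it the
  -- definedness of g. Hence the iterates form a chain.
  pow-inflationary : ∀ g k {x gx z} → Reach x g gx → x ≼ gx → Reach x (pow g k) z →
    x ≼ z × ∃ λ gz → Reach z g gz × z ≼ gz
  pow-inflationary g zero r x≼gx nil = ≤-refl , _ , r , x≼gx
  pow-inflationary g (suc k) r x≼gx rs with Run-split g rs
  ... | _ , r' , rs' with Run-det r r'
  ...   | refl with Run-mono x≼gx r
  ...     | _ , r'' , gx≼ with pow-inflationary g k r'' gx≼ rs'
  ...       | gx≼z , gz = ≤-trans x≼gx gx≼z , gz

  Iter-mono : ∀ g {x gx} → Reach x g gx → x ≼ gx → ∀ {m n y z} → m ≤ℕ n →
    Reach x (pow g m) y → Reach x (pow g n) z → y ≼ z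
  Iter-mono g r x≼gx {m} m≤n rm rn with ℕ.m≤n⇒∃[o]m+o≡n m≤n
  ... | d , refl with Run-pow-split g m d rn
  ...   | _ , rm' , rd with Run-det rm rm' | pow-inflationary g m r x≼gx rm
  ...     | refl | _ , _ , ry , y≼ = proj₁ (pow-inflationary g d ry y≼ rd)

  Iter-directed : ∀ g {x gx} → Reach x g gx → x ≼ gx → Directed _≼_ (Iter (trans T) _≼_ g x)
  Iter-directed g r x≼gx = (_ , 0 , nil) , ub
    where
    ub : ∀ y z → Iter (trans T) _≼_ g _ y → Iter (trans T) _≼_ g _ z → _
    ub y z (m , rm) (n , rn) with ℕ.≤-total m n
    ... | inj₁ m≤n = z , (n , rn) , Iter-mono g r x≼gx m≤n rm rn , ≤-refl
    ... | inj₂ n≤m = y , (m , rm) , ≤-refl , Iter-mono g r x≼gx n≤m rn rm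

  LubAcc-closed : ∀ {C} → ScottClosed _≼_ C → ∀ {g x y} → LubAcc (trans T) _≼_ g x y →
    (∀ u z → InStar g u → Reach x u z → C z) → C y
  LubAcc-closed closed {g} (gx , r , inj₁ ((x≼gx , _) , lub)) c =
    closed-lub closed (Iter-directed g r x≼gx) lub λ { z (k , rk) → c _ z (InStar-pow g k) rk }
  LubAcc-closed closed {g} (gx , r , inj₂ (_ , refl)) c =
    c g gx (subst (InStar g) (pow-1 g) (InStar-pow g 1)) r

  Run≤LubAcc : ∀ {g x y z} → LubAcc (trans T) _≼_ g x y → Reach x g z → z ≼ y
  Run≤LubAcc {g} (gx , _ , inj₁ (_ , ub , _)) r = ub _ (1 , subst (λ u → Reach _ u _) (sym (pow-1 g)) r)
  Run≤LubAcc (gx , r , inj₂ (_ , refl)) r' with Run-det r r'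
  ... | refl = ≤-refl

  Run⇒Cover : ∀ {s u y} → Reach s u y → CoverOf T s y
  Run⇒Cover r = _ , ≤-refl , _ , _ , r , ≤-refl

  module _ {s₀ : State T} (c : Choices T s₀) where

    open Choices c

    chosenWords : ℕ → List (List (Fin (nF T)))
    chosenWords zero = []
    chosenWords (suc k) = chosenWords k ++ [ g k ]

    Aₘ-mono : ∀ {m n} → m ≤ℕ n → ∀ {x} → x ∈ Aₘ T s₀ c m → x ∈ Aₘ T s₀ c n
    Aₘ-mono {n = zero} z≤n x∈ = x∈
    Aₘ-mono {n = suc n} m≤sn x∈ with ℕ.m≤n⇒m<n∨m≡n m≤sn
    ... | inj₁ (s≤s m≤n) = ∈-++⁺ˡ (Aₘ-mono m≤n x∈)
    ... | inj₂ refl = x∈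

    -- The states in A lie in the closure of those reached along g₀* ⋯ gₖ₋₁*. Quantifying over all
    -- closed sets drives the induction: for the last word it is applied to the closed set of states
    -- whose runs along iterates of that word all end in `C`.
    Aₘ-closed : ValidChoices T s₀ c → ∀ k {C} → ScottClosed _≼_ C →
      (∀ u z → InStars (chosenWords k) u → Reach s₀ u z → C z) → ∀ a → a ∈ Aₘ T s₀ c k → C a
    Aₘ-closed valid zero closed h _ (here refl) = h [] _ done nil
    Aₘ-closed valid (suc k) {C} closed h b b∈ with ∈-++⁻ (Aₘ T s₀ c k) b∈
    ... | inj₁ b∈k = Aₘ-closed valid k closed
      (λ u z i → h u z (subst (InStars _) (++-identityʳ u) (InStars-++ i (InStars-[] [ g k ])))) b b∈k
    ... | inj₂ (here refl) with valid k
    ...   | a∈k , _ , acc = LubAcc-closed closed acc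
      (Aₘ-closed valid k (Run-preimage-closed (InStar (g k)) closed)
        (λ u z i r v z' j r' → h (u ++ v) z' (InStars-++ i (next j done (sym (++-identityʳ v)))) (Run-++ r r'))
        (a k) a∈k)

  -- Decidability, and finitely generated down-sets

  module _ (eff : Effective T) where

    infix 4 _≼?_ _≟_
    _≼?_ : ∀ x y → Dec (x ≼ y)
    x ≼? y with surj eff x | surj eff y
    ... | m , refl | k , refl = dec≤ eff m k

    _≟_ : DecidableEquality (State T)
    x ≟ y = map′ (λ { (p , q) → ≤-antisym p q }) (λ { refl → ≤-refl , ≤-refl }) (x ≼? y ×-dec y ≼? x)

    dom? : ∀ f x → Dec (dom (trans T f) x)
    dom? f x with surj eff x
    ... | m , refl = decDom eff f m

    InDom? : ∀ w x → Dec (InDom (trans T) w x)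
    InDom? [] x = yes (x , nil)
    InDom? (f ∷ w) x with dom? f x
    ... | no ¬p = no λ { (_ , cons p _) → ¬p p }
    ... | yes p = map′ (λ { (y , r) → y , cons p r })
                       (λ { (y , cons q r) → y , subst (λ z → Reach z w y) (app-irrelevant f q p) r })
                       (InDom? w (app (trans T f) x p))

    -- A strict pair x < y makes D = {x} ∪ {y ∣ P} directed: comparing its lub with x decides ¬ P,
    -- and any y' ≪ y with y' ≰ x then extracts P from y being the lub.
    strict⇒¬¬LEM : ∀ {x y} → x ≼ y → ¬ y ≼ x → ¬ ¬ (∀ (P : Set) → Dec P)
    strict⇒¬¬LEM {x} {y} x≼y y⋠x ¬lem =
      y⋠x (proj₂ (proj₂ (continuous y)) x λ y' y'≪y → decidable-stable (y' ≼? x) λ y'⋠x →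
        ¬lem (lem y' y'≪y y'⋠x))
      where
      lem : ∀ y' → WayBelow _≼_ y' y → ¬ y' ≼ x → ∀ P → Dec P
      lem y' y'≪y y'⋠x P = decide
        where
        D : State T → Set
        D z = z ≡ x ⊎ (z ≡ y × P)

        D-directed : Directed _≼_ D
        D-directed = (x , inj₁ refl) , λ
          { _ _ (inj₁ refl) (inj₁ refl) → x , inj₁ refl , ≤-refl , ≤-refl
          ; _ _ (inj₁ refl) (inj₂ (refl , p)) → y , inj₂ (refl , p) , x≼y , ≤-refl
          ; _ _ (inj₂ (refl , p)) (inj₁ refl) → y , inj₂ (refl , p) , ≤-refl , x≼y
          ; _ _ (inj₂ (refl , p)) (inj₂ (refl , _)) → y , inj₂ (refl , p) , ≤-refl , ≤-refl }

        D-lub : ¬ ¬ P → IsLub _≼_ D y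
        D-lub ¬¬p = (λ { _ (inj₁ refl) → x≼y ; _ (inj₂ (refl , _)) → ≤-refl }) ,
          λ u ub → decidable-stable (y ≼? u) λ y⋠u → ¬¬p λ p → y⋠u (ub y (inj₂ (refl , p)))

        decide : Dec P
        decide with dcpo D D-directed
        ... | l , ub , least with l ≼? x
        ...   | yes l≼x = no λ p → y⋠x (≤-trans (ub y (inj₂ (refl , p))) l≼x)
        ...   | no l⋠x with y'≪y D D-directed y
                            (D-lub λ ¬p → l⋠x (least x λ { _ (inj₁ refl) → ≤-refl ; _ (inj₂ (_ , p)) → ⊥-elim (¬p p) }))
                            ≤-refl
        ...     | _ , inj₁ refl , y'≼x = ⊥-elim (y'⋠x y'≼x)
        ...     | _ , inj₂ (_ , p) , _ = yes p

    -- If openness fails, so does excluded middle, which would prove it. Then `strict⇒¬¬LEM` rules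
    -- out strict pairs, the order is discrete, and every member of a directed set equals the lub,
    -- which makes openness trivial after all.
    ¬¬-complement-open : ¬ ¬ (∀ b → ScottOpen _≼_ (λ z → ¬ z ≼ b))
    ¬¬-complement-open k = k λ b → up b , discrete-meets b
      where
      up : ∀ b → UpClosed _≼_ (λ z → ¬ z ≼ b)
      up b x y x≼y x⋠b y≼b = x⋠b (≤-trans x≼y y≼b)

      ¬lem : ¬ (∀ (P : Set) → Dec P)
      ¬lem lem = k λ b → up b , λ D dir l lub l⋠b →
        decidable-stable (lem _) λ none → l⋠b (proj₂ lub b λ x Dx →
          decidable-stable (x ≼? b) λ x⋠b → none (x , Dx , x⋠b))

      discrete : ∀ {x y} → x ≼ y → y ≼ x
      discrete {x} {y} x≼y = decidable-stable (y ≼? x) λ y⋠x → strict⇒¬¬LEM x≼y y⋠x ¬lem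

      discrete-meets : ∀ b D → Directed _≼_ D → ∀ l → IsLub _≼_ D l → ¬ l ≼ b → ∃ λ x → D x × ¬ x ≼ b
      discrete-meets b D ((x , Dx) , _) l lub l⋠b =
        x , Dx , λ x≼b → l⋠b (≤-trans (discrete (proj₁ lub x Dx)) x≼b)

    ↓List : List (State T) → State T → Set
    ↓List L x = ∃ λ b → b ∈ L × x ≼ b

    ↓List? : ∀ L x → Dec (↓List L x)
    ↓List? L x = map′ find (λ { (b , b∈ , x≼b) → lose b∈ x≼b }) (Any.any? (x ≼?_) L)

    ↓List-down : ∀ {L x y} → x ≼ y → ↓List L y → ↓List L x
    ↓List-down x≼y (b , b∈ , y≼b) = b , b∈ , ≤-trans x≼y y≼b

    -- The complement is a finite intersection of open sets; directedness merges the witnesses found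
    -- for the separate members of the list.
    ↓List-closed : (∀ b → ScottOpen _≼_ (λ z → ¬ z ≼ b)) → ∀ L → ScottClosed _≼_ (↓List L)
    ↓List-closed ⋠-open L = (λ z → ¬ ↓List L z) , complement-open L ,
      λ x → mk⇔ (λ c ¬c → ¬c c) (decidable-stable (↓List? L x))
      where
      complement-open : ∀ L → ScottOpen _≼_ (λ z → ¬ ↓List L z)
      complement-open L = (λ x y x≼y x∉ y∈ → x∉ (↓List-down x≼y y∈)) , meets L
        where
        meets : ∀ L D → Directed _≼_ D → ∀ l → IsLub _≼_ D l → ¬ ↓List L l → ∃ λ x → D x × ¬ ↓List L x
        meets [] D ((x , Dx) , _) l lub _ = x , Dx , λ { (_ , () , _) }
        meets (b ∷ L) D dir l lub l∉
          with proj₂ (⋠-open b) D dir l lub (λ l≼b → l∉ (b , here refl , l≼b))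
             | meets L D dir l lub (λ { (b' , b'∈ , l≼b') → l∉ (b' , there b'∈ , l≼b') })
        ... | x , Dx , x⋠b | y , Dy , y∉ with proj₂ dir x y Dx Dy
        ...   | z , Dz , x≼z , y≼z = z , Dz , λ
          { (_ , here refl , z≼b) → x⋠b (≤-trans x≼z z≼b)
          ; (b' , there b'∈ , z≼b') → y∉ (b' , b'∈ , ≤-trans y≼z z≼b') }

    -- Fair executions cover w₁* ⋯ wₖ*

    module Execution {s₀ : State T} (c : Choices T s₀)
                     (valid : ValidChoices T s₀ c) (fair : FairChoices T s₀ c) where

      open Choices c

      private
        A : ℕ → List (State T)
        A = Aₘ T s₀ c

      Covered : ℕ → State T → Set
      Covered m = ↓List (A m)

      Covered-mono : ∀ {m n x} → m ≤ℕ n → Covered m x → Covered n x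
      Covered-mono m≤n (b , b∈ , x≼b) = b , Aₘ-mono c m≤n b∈ , x≼b

      Eventually : ℕ → (ℕ → Set) → Set
      Eventually m P = ∃ λ n → m ≤ℕ n × P n

      accelerate : ∀ m {b h} → b ∈ A m → InDom (trans T) h b →
        Eventually m λ n → ∃ λ z → z ∈ A n × LubAcc (trans T) _≼_ h b z
      accelerate m {b} {h} b∈ d with fair m h b b∈ d
      ... | k , m≤k , refl , refl =
        -- The value computed at iteration k belongs to A only from k + 1 on.
        suc k , ℕ.m≤n⇒m≤1+n m≤k , y k , ∈-++⁺ʳ (A k) (here refl) , proj₂ (proj₂ (valid k))

      -- Finitely many powers need no cleverness: fairness eventually picks each enabled pair (wⁿ,
      -- b), and wⁿ(b) lies below the result of its acceleration.
      cover-below : ∀ w m {b} → b ∈ A m → ∀ N →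
        Eventually m λ m' → ∀ n z → n < N → Reach b (pow w n) z → Covered m' z
      cover-below w m b∈ zero = m , ℕ.≤-refl , λ _ _ ()
      cover-below w m {b} b∈ (suc N) with cover-below w m b∈ N
      ... | m₁ , m≤m₁ , cov with InDom? (pow w N) b
      ...   | no undefined = m₁ , m≤m₁ , cov'
        where
        cov' : ∀ n z → n < suc N → Reach b (pow w n) z → Covered m₁ z
        cov' n z (s≤s n≤N) r with ℕ.m≤n⇒m<n∨m≡n n≤N
        ... | inj₁ n<N = cov n z n<N r
        ... | inj₂ refl = ⊥-elim (undefined (z , r))
      ...   | yes d with accelerate m₁ (Aₘ-mono c m≤m₁ b∈) d
      ...     | m₂ , m₁≤m₂ , t , t∈ , acc = m₂ , ℕ.≤-trans m≤m₁ m₁≤m₂ , cov'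
        where
        cov' : ∀ n z → n < suc N → Reach b (pow w n) z → Covered m₂ z
        cov' n z (s≤s n≤N) r with ℕ.m≤n⇒m<n∨m≡n n≤N
        ... | inj₁ n<N = Covered-mono m₁≤m₂ (cov n z n<N r)
        ... | inj₂ refl = t , t∈ , Run≤LubAcc acc r

      -- With n = qp + r and r < p, the state wⁿ(x) lies below wʳ(t), and only finitely many r
      -- occur.
      cover-periodic : ∀ w m p .{{_ : NonZero p}} {x t} → t ∈ A m →
        (∀ k z → Reach x (pow w (k * p)) z → z ≼ t) →
        Eventually m λ m' → ∀ n z → Reach x (pow w n) z → Covered m' z
      cover-periodic w m p {x} {t} t∈ bound with cover-below w m t∈ p
      ... | m' , m≤m' , cov = m' , m≤m' , cov'
        where
        cov' : ∀ n z → Reach x (pow w n) z → Covered m' z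
        cov' n z r with Run-pow-split w ((n / p) * p) (n % p)
          (subst (λ k → Reach x (pow w k) z) (≡-trans (m≡m%n+[m/n]*n n p) (ℕ.+-comm (n % p) _)) r)
        ... | y' , r₁ , r₂ with Run-mono (bound (n / p) y' r₁) r₂
        ...   | z' , r₂' , z≼z' = ↓List-down z≼z' (cov (n % p) z' (m%n<n n p) r₂')

      module _ (w : List (Fin (nF T))) {b : State T} where

        orbit : ℕ → State T
        orbit n with InDom? (pow w n) b
        ... | yes (z , _) = z
        -- A default value, which makes the orbit total as the wpo property requires; `cover-orbit`
        -- treats undefined powers separately.
        ... | no _ = b

        orbit-Run : ∀ n {z} → Reach b (pow w n) z → orbit n ≡ z
        orbit-Run n r with InDom? (pow w n) b
        ... | yes (_ , r') = Run-det r' r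
        ... | no undefined = ⊥-elim (undefined (_ , r))

        -- By monotonicity wʲ⁺ᵉ(b) lies below wⁱ⁺ᵉ(b), a smaller exponent, so strong induction
        -- reduces everything to exponents below j.
        cover-descending : ∀ {m i j xi xj} → i < j → Reach b (pow w i) xi → Reach b (pow w j) xj → xj ≼ xi →
          (∀ n z → n < j → Reach b (pow w n) z → Covered m z) →
          ∀ n z → Reach b (pow w n) z → Covered m z
        cover-descending {m} {i} {j} i<j ri rj xj≼xi cov =
          <-rec (λ n → ∀ z → Reach b (pow w n) z → Covered m z) step
          where
          step : ∀ n → (∀ {k} → k < n → ∀ z → Reach b (pow w k) z → Covered m z) →
            ∀ z → Reach b (pow w n) z → Covered m z
          step n rec z r with n <? j
          ... | yes n<j = cov n z n<j r
          ... | no n≮j with ℕ.m≤n⇒∃[o]m+o≡n (ℕ.≮⇒≥ n≮j)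
          ...   | e , refl with Run-pow-split w j e r
          ...     | _ , rj' , re with Run-det rj rj'
          ...       | refl with Run-mono xj≼xi re
          ...         | z' , re' , z≼z' = ↓List-down z≼z'
            (rec (ℕ.+-monoˡ-< e i<j) z' (subst (λ u → Reach b u z') (sym (pow-+ w i e)) (Run-++ ri re')))

        cover-after : ∀ i m {xi} → b ∈ A m → Reach b (pow w i) xi →
          (∀ n z → Reach xi (pow w n) z → Covered m z) →
          Eventually m λ m' → ∀ n z → Reach b (pow w n) z → Covered m' z
        cover-after i m b∈ ri cov with cover-below w m b∈ i
        ... | m' , m≤m' , cov< = m' , m≤m' , cov'
          where
          cov' : ∀ n z → Reach b (pow w n) z → Covered m' z
          cov' n z r with n <? i
          ... | yes n<i = cov< n z n<i r
          ... | no n≮i with ℕ.m≤n⇒∃[o]m+o≡n (ℕ.≮⇒≥ n≮i)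
          ...   | e , refl with Run-pow-split w i e r
          ...     | _ , ri' , re with Run-det ri ri'
          ...       | refl = Covered-mono m≤m' (cov e z re)

        -- The state wⁱ(b) need not belong to A, so wⁱ is first accelerated from b. If b < wⁱ(b),
        -- the result bounds all powers of wⁱ, and i is a period.
        cover-increasing : ∀ m i d {xi xj} → b ∈ A m → Reach b (pow w i) xi → Reach xi (pow w (suc d)) xj →
          xi ≼ xj → xi ≢ xj → Eventually m λ m' → ∀ n z → Reach b (pow w n) z → Covered m' z
        cover-increasing m i d b∈ ri rd xi≼xj xi≢xj with accelerate m b∈ (_ , ri)
        ... | m₁ , m≤m₁ , t , t∈ , gx , r , inj₁ ((_ , b≢gx) , ub , _) with i
        ...   | zero = ⊥-elim (b≢gx (Run-det nil r))
        ...   | suc i' with cover-periodic w m₁ (suc i') t∈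
                            (λ k z rk → ub z (k , subst (λ u → Reach b u z) (sym (pow-* w k (suc i'))) rk))
        ...     | m₂ , m₁≤m₂ , cov = m₂ , ℕ.≤-trans m≤m₁ m₁≤m₂ , cov
        -- Otherwise the acceleration returns exactly wⁱ(b), which thereby enters A. It lies
        -- strictly below its image under wᵈ⁺¹, so a second acceleration yields the period d + 1,
        -- and the powers below i are added separately.
        cover-increasing m i d b∈ ri rd xi≼xj xi≢xj | m₁ , m≤m₁ , t , t∈ , gx , r , inj₂ (_ , refl)
          with Run-det r ri
        ... | refl with accelerate m₁ t∈ (_ , rd)
        ...   | m₂ , m₁≤m₂ , t' , t'∈ , gx' , r' , inj₂ (¬lt , _) =
          ⊥-elim (¬lt (subst (λ x → gx ≼ x × gx ≢ x) (Run-det rd r') (xi≼xj , xi≢xj)))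
        ...   | m₂ , m₁≤m₂ , t' , t'∈ , gx' , r' , inj₁ (_ , ub , _)
          with cover-periodic w m₂ (suc d) t'∈
                 (λ k z rk → ub z (k , subst (λ u → Reach gx u z) (sym (pow-* w k (suc d))) rk))
        ...     | m₃ , m₂≤m₃ , cov with cover-after i m₃ (Aₘ-mono c (ℕ.≤-trans m≤m₁ (ℕ.≤-trans m₁≤m₂ m₂≤m₃)) b∈) ri cov
        ...       | m₄ , m₃≤m₄ , cov' =
          m₄ , ℕ.≤-trans m≤m₁ (ℕ.≤-trans m₁≤m₂ (ℕ.≤-trans m₂≤m₃ m₃≤m₄)) , cov'

        -- The wpo property supplies wⁱ(b) ≤ wʲ(b); deciding the converse inequality separates a
        -- repetition from strict growth.
        cover-orbit : ∀ m → b ∈ A m → Eventually m λ m' → ∀ n z → Reach b (pow w n) z → Covered m' z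
        cover-orbit m b∈ with wpo orbit
        ... | i , j , i<j , le with InDom? (pow w j) b
        -- If wʲ is undefined at b, so are all higher powers, and only those below j matter.
        ...   | no undefined with cover-below w m b∈ j
        ...     | m' , m≤m' , cov = m' , m≤m' , cov'
          where
          cov' : ∀ n z → Reach b (pow w n) z → Covered m' z
          cov' n z r with n <? j
          ... | yes n<j = cov n z n<j r
          ... | no n≮j with ℕ.m≤n⇒∃[o]m+o≡n (ℕ.≮⇒≥ n≮j)
          ...   | e , refl with Run-pow-split w j e r
          ...     | x , rj , _ = ⊥-elim (undefined (x , rj))
        cover-orbit m b∈ | i , j , i<j , le | yes (xj , rj) with ℕ.m≤n⇒∃[o]m+o≡n i<j
        ... | d , refl with Run-pow-split w i (suc d) (subst (λ k → Reach b (pow w k) xj) (sym (ℕ.+-suc i d)) rj)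
        ...   | xi , ri , rd with xj ≼? xi
        ...     | no xj⋠xi = cover-increasing m i d b∈ ri rd xi≼xj λ { refl → xj⋠xi ≤-refl }
          where
          xi≼xj : xi ≼ xj
          -- The case split on `InDom?` has already reduced `orbit j` to `xj`; only the left side
          -- remains to be identified.
          xi≼xj = subst (_≼ xj) (orbit-Run i ri) le
        ...     | yes xj≼xi with cover-below w m b∈ j
        ...       | m' , m≤m' , cov = m' , m≤m' , cover-descending {m'} i<j ri rj xj≼xi cov

      cover-orbits : ∀ w m L → (∀ a → a ∈ L → a ∈ A m) →
        Eventually m λ m' → ∀ a n z → a ∈ L → Reach a (pow w n) z → Covered m' z
      cover-orbits w m [] _ = m , ℕ.≤-refl , λ { _ _ _ () }
      cover-orbits w m (b ∷ L) L⊆A with cover-orbits w m L (λ a a∈ → L⊆A a (there a∈))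
      ... | m₁ , m≤m₁ , cov with cover-orbit w m₁ (Aₘ-mono c m≤m₁ (L⊆A b (here refl)))
      ...   | m₂ , m₁≤m₂ , cov' = m₂ , ℕ.≤-trans m≤m₁ m₁≤m₂ , λ
        { a n z (here refl) r → cov' n z r
        ; a n z (there a∈) r → Covered-mono m₁≤m₂ (cov a n z a∈ r) }

      -- The starred words are treated from left to right. Once the orbits under w₁ are covered,
      -- monotonicity moves the rest of the run to a larger start inside A, which is why the claim
      -- ranges over all of A.
      cover-stars : ∀ ws m → Eventually m λ m' → ∀ a u z → a ∈ A m → InStars ws u → Reach a u z → Covered m' z
      cover-stars [] m = m , ℕ.≤-refl , λ { a _ _ a∈ done nil → a , a∈ , ≤-refl }
      cover-stars (w ∷ ws) m with cover-orbits w m (A m) (λ _ a∈ → a∈)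
      ... | m₁ , m≤m₁ , cov with cover-stars ws m₁
      ...   | m₂ , m₁≤m₂ , cov' = m₂ , ℕ.≤-trans m≤m₁ m₁≤m₂ , cov''
        where
        cov'' : ∀ a u z → a ∈ A m → InStars (w ∷ ws) u → Reach a u z → Covered m₂ z
        cov'' a u z a∈ (next {u = u₁} i j refl) r with InStar⇒pow i
        ... | n , refl with Run-split (pow w n) r
        ...   | y' , r₁ , r₂ with cov a n y' a∈ r₁
        ...     | b , b∈ , y'≼b with Run-mono y'≼b r₂
        ...       | z' , r₂' , z≼z' = ↓List-down z≼z' (cov' b _ z' b∈ j r₂')

-- Clover-flattable implies weakly clover-flattable

clover⇒weak : ∀ T s₀ → CloverFlattable T s₀ → WeaklyCloverFlattable T s₀
clover⇒weak T s₀ (fl , s₁ , cont , flat , φs₁≡s₀ , cl⊆ , _) =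
  fl , s₁ , cont , flat , IsPartialOrder.reflexive (isPO T) φs₁≡s₀ , cl⊆

-- The synchronized product as a continuous flattening

module Product (T : OTS) (complete : IsComplete T) (𝒜 : RLAutomaton (nF T)) where

  open IsComplete complete
  open System T complete

  infix 4 _≼×_
  _≼×_ : ProdState T 𝒜 → ProdState T 𝒜 → Set
  _≼×_ = _≤×_ T 𝒜

  ≼×-isPartialOrder : IsPartialOrder _≡_ _≼×_
  ≼×-isPartialOrder = record
    { isPreorder = record
      { isEquivalence = isEquivalence
      ; reflexive = λ { refl → ≤-refl , refl }
      ; trans = λ { (s≼t , q≡r) (t≼u , r≡p) → ≤-trans s≼t t≼u , ≡-trans q≡r r≡p }
      }
    ; antisym = λ { (s≼t , refl) (t≼s , _) → cong (_, _) (≤-antisym s≼t t≼s) }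
    }

  product : OTS
  product = record
    { State = ProdState T 𝒜 ; _≤_ = _≼×_ ; isPO = ≼×-isPartialOrder ; nF = nF T ; trans = prodMap T 𝒜 }

  -- Comparable product states share their automaton state, so a directed set lives in a single copy
  -- of the original order.
  slice-directed : ∀ {D s q} → Directed _≼×_ D → D (s , q) → Directed _≼_ (λ x → D (x , q))
  slice-directed (_ , ub) Dsq = (_ , Dsq) , λ x y Dx Dy → slice (ub _ _ Dx Dy)
    where
    slice : ∀ {D : ProdState T 𝒜 → Set} {x y q} → (∃ λ z → D z × (x , q) ≼× z × (y , q) ≼× z) →
      ∃ λ z → D (z , q) × x ≼ z × y ≼ z
    slice ((z , _) , Dz , (x≼z , refl) , (y≼z , _)) = z , Dz , x≼z , y≼z

  slice : ∀ {D l q} → Directed _≼×_ D → IsLub _≼×_ D (l , q) →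
    Directed _≼_ (λ x → D (x , q)) × IsLub _≼_ (λ x → D (x , q)) l
  slice {D} {l} {q} dir@(((s , q') , Dsq') , _) (ub , least) with ub _ Dsq'
  ... | _ , refl = slice-directed dir Dsq' ,
    (λ x Dx → proj₁ (ub _ Dx)) , λ u u-ub → proj₁ (least (u , q) λ { (x , q″) Dx → above x q″ Dx (ub _ Dx) u u-ub })
    where
    above : ∀ x q″ → D (x , q″) → (x , q″) ≼× (l , q) → ∀ u → UpperBound _≼_ (λ x → D (x , q)) u → (x , q″) ≼× (u , q)
    above x _ Dx (_ , refl) u u-ub = u-ub x Dx , refl

  product-dcpo : IsDcpo _≼×_
  product-dcpo D dir@(((s , q) , Dsq) , joins) with dcpo _ (slice-directed dir Dsq)
  ... | l , ub , least = (l , q) , upper , λ { (u , r) u-ub → below u r u-ub (proj₂ (u-ub _ Dsq)) }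
    where
    upper : UpperBound _≼×_ D (l , q)
    upper (x , r) Dx with joins _ _ Dx Dsq
    ... | (z , _) , _ , (_ , refl) , (_ , refl) = ub x Dx , refl

    below : ∀ u r → UpperBound _≼×_ D (u , r) → q ≡ r → (l , q) ≼× (u , r)
    below u _ u-ub refl = least u (λ x Dx → proj₁ (u-ub _ Dx)) , refl

  WayBelow-×⁺ : ∀ {x y q} → WayBelow _≼_ x y → WayBelow _≼×_ (x , q) (y , q)
  WayBelow-×⁺ x≪y D dir (l , _) lub (y≼l , refl) with slice dir lub
  ... | dir' , lub' with x≪y _ dir' l lub' y≼l
  ...   | z , Dz , x≼z = _ , Dz , x≼z , refl

  WayBelow-×⁻ : ∀ {x y q r} → WayBelow _≼×_ (x , q) (y , r) → WayBelow _≼_ x y × q ≡ r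
  WayBelow-×⁻ {x} {y} {q} {r} x≪y = x≪y' , proj₂ x≼y
    where
    x≼y : (x , q) ≼× (y , r)
    -- The singleton of (y , r) is directed with lub (y , r).
    x≼y with x≪y (_≡ (y , r)) ((_ , refl) , λ { _ _ refl refl → _ , refl , (≤-refl , refl) , (≤-refl , refl) })
               _ ((λ { _ refl → ≤-refl , refl }) , λ u ub → ub _ refl) (≤-refl , refl)
    ... | _ , refl , le = le

    x≪y' : WayBelow _≼_ x y
    x≪y' D ((d , Dd) , ub) l (l-ub , least) y≼l
      -- `D` is placed in the copy indexed by `r`, where it stays directed with lub (l , r).
      with x≪y (λ { (s , t) → D s × t ≡ r })
             ((_ , Dd , refl) , λ { (s , _) (t , _) (Ds , refl) (Dt , refl) →
               let z , Dz , s≼z , t≼z = ub s t Ds Dt in _ , (Dz , refl) , (s≼z , refl) , (t≼z , refl) })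
             (l , r)
             ((λ { (s , _) (Ds , refl) → l-ub s Ds , refl }) , λ { (u , t) u-ub →
               least u (λ s Ds → proj₁ (u-ub _ (Ds , refl))) , proj₂ (u-ub _ (Dd , refl)) })
             (y≼l , refl)
    ... | (z , _) , (Dz , _) , x≼z , _ = z , Dz , x≼z

  product-continuous : IsContinuous _≼×_
  product-continuous (s , q) with continuous s
  ... | ((y , y≪s) , joins) , ub , least =
    ((_ , WayBelow-×⁺ y≪s) , λ { (a , _) (b , _) a≪s b≪s → join a b (WayBelow-×⁻ a≪s) (WayBelow-×⁻ b≪s) }) ,
    (λ { (a , _) a≪s → ub a (proj₁ (WayBelow-×⁻ a≪s)) , proj₂ (WayBelow-×⁻ a≪s) }) ,
    λ { (u , r) u-ub → least u (λ a a≪s → proj₁ (u-ub _ (WayBelow-×⁺ a≪s))) , proj₂ (u-ub _ (WayBelow-×⁺ y≪s)) }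
    where
    join : ∀ a b {q₁ q₂} → WayBelow _≼_ a s × q₁ ≡ q → WayBelow _≼_ b s × q₂ ≡ q →
      ∃ λ u → WayBelow _≼×_ u (s , q) × (a , q₁) ≼× u × (b , q₂) ≼× u
    join a b (a≪s , refl) (b≪s , refl) with joins a b a≪s b≪s
    ... | u , u≪s , a≼u , b≼u = _ , WayBelow-×⁺ u≪s , (a≼u , refl) , (b≼u , refl)

  product-pcont : ∀ f → PartialContinuous _≼×_ (prodMap T 𝒜 f)
  product-pcont f = (up , meets) , preserves
    where
    up : UpClosed _≼×_ (dom (prodMap T 𝒜 f))
    up (s , q) (t , _) (s≼t , refl) (p , q') = dom-up f s≼t p , q'

    meets : ∀ D → Directed _≼×_ D → ∀ l → IsLub _≼×_ D l → dom (prodMap T 𝒜 f) l →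
      ∃ λ x → D x × dom (prodMap T 𝒜 f) x
    meets D dir (l , q) lub (p , q') with slice dir lub
    ... | dir' , lub' with proj₂ (proj₁ (pcont f)) _ dir' l lub' p
    ...   | x , Dx , px = (x , q) , Dx , px , q'

    preserves : ∀ D (sub : ∀ x → D x → dom (prodMap T 𝒜 f) x) → Directed _≼×_ D →
      ∀ l → IsLub _≼×_ D l → (p : dom (prodMap T 𝒜 f) l) →
      IsLub _≼×_ (λ y → ∃ λ x → Σ (D x) λ d → y ≡ app (prodMap T 𝒜 f) x (sub x d)) (app (prodMap T 𝒜 f) l p)
    preserves D sub dir (l , q) lub (p , q' , e) with slice dir lub
    ... | dir'@((x₀ , Dx₀) , _) , lub'
      with proj₂ (pcont f) _ (λ x d → proj₁ (sub (x , q) d)) dir' l lub' p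
    ...   | f-ub , f-least = upper , λ { (u , r) u-ub →
      f-least u (λ { _ (x , d , refl) → proj₁ (u-ub _ (_ , d , refl)) }) ,
      ≡-trans (target≡ (sub _ Dx₀)) (proj₂ (u-ub _ (_ , Dx₀ , refl))) }
      where
      -- All these successor states are read off the same value of δ at q and f.
      target≡ : ∀ {x} (px : dom (prodMap T 𝒜 f) (x , q)) → q' ≡ proj₁ (proj₂ px)
      target≡ (_ , _ , e') = just-injective (≡-trans (sym e) e')

      upper : UpperBound _≼×_ _ _
      upper _ ((x , r) , d , refl) with proj₂ (proj₁ lub _ d)
      ... | refl = f-ub _ (x , d , refl) , sym (target≡ (sub _ d))

  product-complete : IsComplete product
  product-complete = record
    { dcpo = product-dcpo
    ; continuous = product-continuous
    ; wpo = WpoProduct.wpo-×-Fin _≼_ wpo (nQ 𝒜)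
    ; pcont = product-pcont
    }

  proj₁-continuous : ScottContinuous _≼×_ _≼_ proj₁
  proj₁-continuous U (U-up , U-meets) =
    (λ { (x , _) (y , _) (x≼y , _) → U-up x y x≼y }) ,
    λ { D dir (l , q) lub Ul →
      let dir' , lub' = slice dir lub ; x , Dx , Ux = U-meets _ dir' l lub' Ul in (x , q) , Dx , Ux }

  Run-×⁻ : ∀ {s q w t r} → Run (prodMap T 𝒜) (s , q) w (t , r) → Reach s w t × δ* (δ 𝒜) q w ≡ just r
  Run-×⁻ nil = nil , refl
  Run-×⁻ {w = f ∷ w} (cons (p , _ , e) π) with Run-×⁻ π
  ... | ρ , e' rewrite e = cons p ρ , e'

  Run-×⁺ : ∀ {s q w t r} → Reach s w t → δ* (δ 𝒜) q w ≡ just r → Run (prodMap T 𝒜) (s , q) w (t , r)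
  Run-×⁺ nil refl = nil
  Run-×⁺ {q = q} (cons {f = f} p ρ) e with δ 𝒜 q f in eq
  ... | just q' = cons (p , q' , eq) (Run-×⁺ ρ e)

  ProdCover⇒Cover : ∀ {s₀ q x r} → ProdCover T 𝒜 (s₀ , q) (x , r) → CoverOf T s₀ x
  ProdCover⇒Cover ((a , _) , (a≼s₀ , _) , w , (y , _) , ρ , x≼y , _) =
    a , a≼s₀ , w , y , proj₁ (Run-×⁻ ρ) , x≼y

  -- A word fireable in the product is accepted by the automaton, hence is a prefix of a word of w₁*
  -- ⋯ wₖ*.
  product-flat : ∀ s₀ → Flat product (s₀ , q₀ 𝒜)
  product-flat s₀ = withPrefixes (ws 𝒜) , λ { w (_ , ρ) →
    Pfx-InStars (ws 𝒜) w (to (recog 𝒜 w) (_ , proj₂ (Run-×⁻ ρ))) }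

  productFlattening : Flattening T
  productFlattening = record
    { T₁ = product ; φ = proj₁ ; φF = λ f → f ; hom = λ { f (s , q) (p , _) → p , refl } }

strong⇒clover : ∀ T → IsComplete T → ∀ s₀ → StronglyCloverFlattable T s₀ → CloverFlattable T s₀
strong⇒clover T complete s₀ (𝒜 , cl≐) =
  productFlattening , (s₀ , q₀ 𝒜) , (product-complete , proj₁-continuous) , product-flat s₀ , refl , cl≐
  where open Product T complete 𝒜

-- Termination of the procedure and flattability

module _ (T : OTS) (complete : IsComplete T) (eff : InfEffective T) (s₀ : State T) where

  open System T complete

  private
    eff₀ : Effective T
    eff₀ = effective eff

  weak⇒terminates : WeaklyCloverFlattable T s₀ → CloverTerminates T s₀
  weak⇒terminates (fl , s₁ , (complete₁ , φ-cont) , (ws , flat) , φs₁≼s₀ , cl⊆) c valid fair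
    -- The starting index is 0, where A contains `s₀`.
    with Execution.cover-stars eff₀ c valid fair (map (map (φF fl)) ws) 0
  ... | m , _ , cov = m , λ x x∈ → decidable-stable (↓List? eff₀ A x)
                            λ x∉ → ¬¬-complement-open eff₀ λ ⋠-open → x∉ (post ⋠-open x x∈)
    where
    module T₁ = System (T₁ fl) complete₁

    A : List (State T)
    A = Aₘ T s₀ c m

    map-InStar : ∀ {w u} → InStar w u → InStar (map (φF fl) w) (map (φF fl) u)
    map-InStar none = none
    map-InStar {w} (more {u} i) = subst (InStar _) (sym (map-++ (φF fl) w u)) (more (map-InStar i))

    map-InStars : ∀ {ws u} → InStars ws u → InStars (map (map (φF fl)) ws) (map (φF fl) u)
    map-InStars done = done
    map-InStars (next {u = u} {v = v} i j refl) = next (map-InStar i) (map-InStars j) (map-++ (φF fl) u v)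

    map-Run : ∀ {x w y} → T₁.Reach x w y → Reach (φ fl x) (map (φF fl) w) (φ fl y)
    map-Run nil = nil
    map-Run (cons {x = x} {f = f} {w = w} p r) with hom fl f x p
    ... | q , e = cons q (subst (λ z → Reach z _ _) e (map-Run r))

    post : (∀ b → ScottOpen _≼_ (λ z → ¬ z ≼ b)) → ∀ x → (∃ λ y → PostL (trans T) A y × x ≼ y) → ∃ λ b → b ∈ A × x ≼ b
    post ⋠-open x (_ , (f , a , a∈ , p , refl) , x≼fa) = ↓List-down eff₀ x≼fa
      (cl⊆ (app (trans T f) a p) fa∈cl (↓List eff₀ A) closed λ { _ (z , z∈ , refl) →
        z∈ _ (preimage-closed φ-cont closed) λ z' → cover⊆ z' })
      where
      closed : ScottClosed _≼_ (↓List eff₀ A)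
      closed = ↓List-closed eff₀ ⋠-open A

      fa∈cl : clOf T (CoverOf T s₀) (app (trans T f) a p)
      -- For closed `C`, the states whose image under f lies in `C` wherever f is defined form a
      -- closed set. It contains everything reachable from `s₀`, hence also a.
      fa∈cl C C-closed cover⊆C = Aₘ-closed c valid m (Run-preimage-closed (_≡ f ∷ []) C-closed)
        (λ { u z _ r _ z' refl r' → cover⊆C z' (Run⇒Cover (Run-++ r r')) }) a a∈ _ _ refl (cons p nil)

      cover⊆ : ∀ z → CoverOf (T₁ fl) s₁ z → ↓List eff₀ A (φ fl z)
      cover⊆ z (a , a≼s₁ , w , y , r , z≼y) with T₁.Run-mono a≼s₁ r
      ... | y' , r' , y≼y' with Run-mono φs₁≼s₀ (map-Run r')
      ...   | y″ , r″ , φy'≼y″ = closed-down (preimage-closed φ-cont closed) (T₁.≤-trans z≼y y≼y')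
        (↓List-down eff₀ φy'≼y″ (cov s₀ _ y″ (here refl) (map-InStars (flat w (y' , r'))) r″))

  open import Data.List.Membership.DecPropositional (_≟_ eff₀) using (_∈?_)
  open Schedule

  record Choice (L : List (State T)) : Set where
    field
      word   : List (Fin (nF T))
      source : State T
      result : State T
      source∈ : source ∈ L
      fireable : InDom (trans T) word source
      acc : LubAcc (trans T) _≼_ word source result
  open Choice

  -- The empty word fired at `s₀` is always a legal choice; it fills the iterations at which the
  -- schedule names a disabled pair.
  idle : ∀ {L} → s₀ ∈ L → Choice L
  idle s₀∈ = record
    { word = [] ; source = s₀ ; result = s₀ ; source∈ = s₀∈ ; fireable = s₀ , nil
    ; acc = s₀ , nil , inj₂ ((λ { (_ , s₀≢s₀) → s₀≢s₀ refl }) , refl) }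

  choose : ∀ {L} → s₀ ∈ L → List (Fin (nF T)) × ℕ → Choice L
  choose {L} s₀∈ (w , e) with code eff₀ e ∈? L | InDom? eff₀ w (code eff₀ e)
  ... | yes e∈ | yes d = record
    { word = w ; source = code eff₀ e ; result = code eff₀ (proj₁ (computeAcc eff w) e)
    ; source∈ = e∈ ; fireable = d ; acc = proj₂ (computeAcc eff w) e d }
  ... | _ | _ = idle s₀∈

  choose-enabled : ∀ {L} (s₀∈ : s₀ ∈ L) w e → code eff₀ e ∈ L → InDom (trans T) w (code eff₀ e) →
    word (choose s₀∈ (w , e)) ≡ w × source (choose s₀∈ (w , e)) ≡ code eff₀ e
  choose-enabled {L} s₀∈ w e e∈ d
    with code eff₀ e ∈? L | InDom? eff₀ w (code eff₀ e)
  ... | yes _ | yes _ = refl , refl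
  ... | no e∉ | _ = ⊥-elim (e∉ e∈)
  ... | yes _ | no ¬d = ⊥-elim (¬d d)

  -- `Aₘ` takes the complete sequence of choices as argument, while each choice here depends on the
  -- current list. The list is therefore built alongside the choices and identified with `Aₘ`
  -- afterwards.
  history : ℕ → ∃ λ L → s₀ ∈ L
  choice : ∀ k → Choice (proj₁ (history k))

  history zero = [ s₀ ] , here refl
  history (suc k) = proj₁ (history k) ++ [ result (choice k) ] , ∈-++⁺ˡ (proj₂ (history k))

  choice k = choose (proj₂ (history k)) (schedule k)

  fairChoices : Choices T s₀
  fairChoices = record
    { g = λ k → word (choice k) ; a = λ k → source (choice k) ; y = λ k → result (choice k) }

  history≡Aₘ : ∀ k → proj₁ (history k) ≡ Aₘ T s₀ fairChoices k
  history≡Aₘ zero = refl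
  history≡Aₘ (suc k) = cong (_++ [ result (choice k) ]) (history≡Aₘ k)

  fairChoices-valid : ValidChoices T s₀ fairChoices
  fairChoices-valid k =
    subst (source (choice k) ∈_) (history≡Aₘ k) (source∈ (choice k)) , fireable (choice k) , acc (choice k)

  fairChoices-fair : FairChoices T s₀ fairChoices
  fairChoices-fair m h b b∈ d with surj eff₀ b
  ... | e , refl with schedule-recurrent m h e
  ...   | k , m≤k , eq = k , m≤k ,
    subst (λ p → word (choose (proj₂ (history k)) p) ≡ h × source (choose (proj₂ (history k)) p) ≡ code eff₀ e)
      (sym eq) (choose-enabled (proj₂ (history k)) h e e∈ d)
    where
    e∈ : b ∈ proj₁ (history k)
    e∈ = subst (b ∈_) (sym (history≡Aₘ k)) (Aₘ-mono fairChoices m≤k b∈)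

  -- On termination the down-set of A contains the cover, and A lies in the closure of what the
  -- chosen words reach. The automaton allows exactly the prefixes of iterates of these words;
  -- conversely, product runs project to runs.
  terminates⇒strong : CloverTerminates T s₀ → StronglyCloverFlattable T s₀
  terminates⇒strong terminates with terminates fairChoices fairChoices-valid fairChoices-fair
  ... | m , post≤ = 𝒜 ,
    (λ x x∈ C C-closed ⊆C → x∈ C C-closed λ y → cover⊆ C C-closed (λ z z∈ → ⊆C z z∈) y) ,
    (λ x x∈ C C-closed cover⊆C → x∈ C C-closed λ { _ ((y , q) , y∈ , refl) →
      y∈ _ (preimage-closed proj₁-continuous C-closed) λ { (z , r) z∈ → cover⊆C z (ProdCover⇒Cover z∈) } })
    where
    𝒜 : RLAutomaton (nF T)
    𝒜 = starAutomaton (chosenWords fairChoices m)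

    open Product T complete 𝒜

    A : List (State T)
    A = Aₘ T s₀ fairChoices m

    s₀∈A : s₀ ∈ A
    s₀∈A = subst (s₀ ∈_) (history≡Aₘ m) (proj₂ (history m))

    -- The loop guard speaks of A only; monotonicity extends it to the down-set of A, and induction
    -- to whole runs.
    post-closed : ∀ {x w y} → (∃ λ b → b ∈ A × x ≼ b) → Reach x w y → ∃ λ b → b ∈ A × y ≼ b
    post-closed x∈ nil = x∈
    post-closed (b , b∈ , x≼b) (cons {f = f} p r) =
      post-closed (post≤ _ (_ , (f , b , b∈ , dom-up f x≼b p , refl) , app-mono f x≼b p _)) r

    cover⊆ : ∀ C → ScottClosed _≼_ C →
      (∀ y → Image proj₁ (cl _≼×_ (ProdCover T 𝒜 (s₀ , q₀ 𝒜))) y → C y) → ∀ x → CoverOf T s₀ x → C x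
    cover⊆ C C-closed ⊆C x (a , a≼s₀ , w , y , r , x≼y) with post-closed (s₀ , s₀∈A , a≼s₀) r
    ... | b , b∈ , y≼b = closed-down C-closed (≤-trans x≼y y≼b)
      (Aₘ-closed fairChoices fairChoices-valid m C-closed reach⊆C b b∈)
      where
      reach⊆C : ∀ u z → InStars (chosenWords fairChoices m) u → Reach s₀ u z → C z
      -- A word of the language is a prefix of itself, so the automaton accepts it and the run lifts
      -- to the product.
      reach⊆C u z i r with from (recog 𝒜 u) ([] , subst (InStars _) (sym (++-identityʳ u)) i)
      ... | q , e = ⊆C z ((z , q) , (λ C' _ cover⊆C' → cover⊆C' _
        (_ , (≤-refl , refl) , u , _ , Run-×⁺ r e , ≤-refl , refl)) , refl)

theorem5p21 : (T : OTS) → IsComplete T → InfEffective T → (s₀ : State T) →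
    (CloverFlattable T s₀ ⇔ WeaklyCloverFlattable T s₀)
    × (CloverFlattable T s₀ ⇔ StronglyCloverFlattable T s₀)
    × (CloverFlattable T s₀ ⇔ CloverTerminates T s₀)
theorem5p21 T complete eff s₀ =
  mk⇔ 1⇒2 (λ h → 3⇒1 (4⇒3 (2⇒4 h))) ,
  mk⇔ (λ h → 4⇒3 (2⇒4 (1⇒2 h))) 3⇒1 ,
  mk⇔ (λ h → 2⇒4 (1⇒2 h)) (λ h → 3⇒1 (4⇒3 h))
  where
  1⇒2 = clover⇒weak T s₀
  2⇒4 = weak⇒terminates T complete eff s₀
  4⇒3 = terminates⇒strong T complete eff s₀
  3⇒1 = strong⇒clover T complete s₀
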